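{- Let $n\ge 4$ and $k\ge 1$ be integers, and choose integers $q_{ij}\ge 2$ for all pairs $1\le i<j\le n$. Define $p_0,p_1,p_2,\dots$ by $p_0=1$, $p_1=q_{12}$ and $p_{j+1}=q_{12}p_j-p_{j-1}$ for $j\ge 1$. Let $Q$ be the quiver on the vertex set $\{1,\dots,n\}$ whose exchange matrix $B(Q)=(b_{ij})$ is given, for $1\le i<j\le n$, by $$b_{ij}=\begin{cases}-p_{2k-2}q_{1j}-p_{2k-1}q_{2j} & \text{if } i=1 \text{ and } 3\le j\le n-1,\\ p_{2k-1}q_{1j}+p_{2k}q_{2j} & \text{if } i=2 \text{ and } 3\le j\le n-1,\\ q_{ij} & \text{otherwise},\end{cases}$$ together with $b_{ii}=0$ and $b_{ji}=-b_{ij}$. Then: (1) applying to $Q$ the mutations at the following vertices, in this order, $$n,\ \underbrace{1,2,\dots,1,2}_{\text{the pair }1,2\text{ repeated }k\text{ times}},\ n-1,\ n-2,\ \dots,\ 2,\ 1,\ \underbrace{2,1,\dots,2,1}_{\text{the pair }2,1\text{ repeated }k\text{ times}}$$ returns the quiver $Q$ (so this is a mutation cycle of length $n+4k$ based at $Q$); (2) all $n+4k$ quivers lying on this mutation cycle (i.e. $Q$ and the quivers obtained from $Q$ after applying the first $j$ of these mutations, $1\le j\le n+4k-1$) are pairwise distinct; (3) this mutation cycle cannot be paved by mutation cycles of length $\le 4k$.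
   Context: A quiver on the vertex set $[1,n]=\{1,\dots,n\}$ is a finite directed multigraph with no loops and no oriented 2-cycles; quivers are labeled, i.e. two quivers are equal only if they are equal as labeled graphs. A quiver $Q$ is encoded by the skew-symmetric integer matrix $B(Q)=(b_{ij})$, where $b_{ij}>0$ means there are $b_{ij}$ arrows from $i$ to $j$. Mutation at a vertex $k$ produces the quiver $\mu[k](Q)$ with matrix $b'_{ij}=-b_{ij}$ if $k\in\{i,j\}$ and $b'_{ij}=b_{ij}+\tfrac12(|b_{ik}|b_{kj}+b_{ik}|b_{kj}|)$ otherwise. A mutation cycle of length $N$ based at $Q$ is a sequence $i_1,\dots,i_N$ of vertices with $i_1\ne i_2\ne\cdots\ne i_N\ne i_1$ (consecutive entries distinct, cyclically), such that applying $\mu[i_1]$, then $\mu[i_2]$, ..., then $\mu[i_N]$ to $Q$ returns $Q$, and no mutation is applied at an isolated vertex. The mutation graph of the mutation class of $Q$ has as vertices all quivers obtainable from $Q$ by sequences of mutations, with an edge labeled $i$ joining $Q'$ and $\mu[i](Q')$; a mutation cycle is a closed walk in this graph. A closed walk in the mutation graph is said to be paved by mutation cycles of length $\le L$ if it becomes null-homotopic in the 2-complex obtained from the mutation graph by attaching a 2-cell along every mutation cycle of length $\le L$. -}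

module Defs where

open import Data.Nat as ℕ using (ℕ; zero; suc; z≤n; s≤s; _∸_)

open import Data.Integer as ℤ using (ℤ; +_; -_; _+_; _-_; _*_; ∣_∣)
open import Data.Integer.DivMod using (_/ℕ_)
open import Data.Fin as Fin using (Fin; zero; suc; toℕ; inject₁; fromℕ)
open import Data.List using (List; []; _∷_; _++_; [_]; length; reverse; map; concat; replicate; allFin)
open import Data.List.Relation.Unary.Linked using (Linked)
open import Data.Product using (_×_)
open import Data.Unit using (⊤)
open import Data.Empty using (⊥)
open import Data.Bool using (Bool; if_then_else_; _∧_)
open import Relation.Nullary using (¬_; does)
open import Relation.Binary.PropositionalEquality using (_≡_; _≢_)
open import Relation.Binary.Construct.Closure.Equivalence using (EqClosure)

-- Quivers on [1,n], encoded by their exchange matrices.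
-- Vertex v ∈ [1,n] is represented by the element v-1 of Fin n.

Matrix : ℕ → Set
Matrix n = Fin n → Fin n → ℤ

_≈Q_ : ∀ {n} → Matrix n → Matrix n → Set
B ≈Q B' = ∀ i j → B i j ≡ B' i j

μ : ∀ {n} → Fin n → Matrix n → Matrix n
μ k B i j =
  if does (i Fin.≟ k) then - B i j
  else if does (j Fin.≟ k) then - B i j
  else B i j + ((+ ∣ B i k ∣) * B k j + B i k * (+ ∣ B k j ∣)) /ℕ 2

mutSeq : ∀ {n} → Matrix n → List (Fin n) → Matrix n
mutSeq B []      = B
mutSeq B (i ∷ w) = mutSeq (μ i B) w

Isolated : ∀ {n} → Matrix n → Fin n → Set
Isolated B i = ∀ j → (B i j ≡ + 0) × (B j i ≡ + 0)

NoIsolatedMutation : ∀ {n} → Matrix n → List (Fin n) → Set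
NoIsolatedMutation B []      = ⊤
NoIsolatedMutation B (i ∷ w) = ¬ Isolated B i × NoIsolatedMutation (μ i B) w

CyclicallyDistinct : ∀ {n} → List (Fin n) → Set
CyclicallyDistinct []      = ⊥
CyclicallyDistinct (x ∷ w) = Linked _≢_ ((x ∷ w) ++ [ x ])

IsMutationCycle : ∀ {n} → Matrix n → List (Fin n) → Set
IsMutationCycle B w =
  CyclicallyDistinct w × NoIsolatedMutation B w × (mutSeq B w ≈Q B)

-- Paving.  A walk in the mutation graph starting at P is a word of
-- labels (the edge labelled i at X goes to μ i X; traversing it back is
-- again label i).  Elementary homotopy moves in the 2-complex obtained
-- by attaching 2-cells along all mutation cycles of length ≤ L:
-- inserting a backtrack i i, or inserting (the boundary of a 2-cell)
-- a mutation cycle of length ≤ L based at the current quiver.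

data PaveStep {n} (L : ℕ) (P : Matrix n) : List (Fin n) → List (Fin n) → Set where
  backtrack : ∀ u v i → PaveStep L P (u ++ v) (u ++ (i ∷ i ∷ []) ++ v)
  cell      : ∀ u v c → IsMutationCycle (mutSeq P u) c → length c ℕ.≤ L →
              PaveStep L P (u ++ v) (u ++ c ++ v)

-- A closed walk w based at P is paved by mutation cycles of length ≤ L
-- iff it is null-homotopic, i.e. related to the empty walk by the
-- equivalence closure of the elementary moves.
PavedBy : ∀ {n} → ℕ → Matrix n → List (Fin n) → Set
PavedBy L P w = EqClosure (PaveStep L P) w []

pseq : ℤ → ℕ → ℤ
pseq a zero          = + 1
pseq a (suc zero)    = a
pseq a (suc (suc j)) = a * pseq a (suc j) - pseq a j

-- Is j (0-based) in the range 3 ≤ j+1 ≤ n-1, i.e. 2 ≤ toℕ j ≤ n ∸ 2 ?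
middle : ∀ {n} → Fin n → Bool
middle {n} j = does (2 ℕ.≤? toℕ j) ∧ does (toℕ j ℕ.≤? n ∸ 2)

-- Entries b_ij for i < j (0-based indices; vertex 1 ↦ zero, vertex 2 ↦ suc zero).
bUpper : ∀ {m} → (q : Fin (suc (suc m)) → Fin (suc (suc m)) → ℤ) (k : ℕ) →
         Fin (suc (suc m)) → Fin (suc (suc m)) → ℤ
bUpper q k zero j =
  if middle j
  then - (pseq (q zero (suc zero)) (2 ℕ.* k ∸ 2) * q zero j)
         - pseq (q zero (suc zero)) (2 ℕ.* k ∸ 1) * q (suc zero) j
  else q zero j
bUpper q k (suc zero) j =
  if middle j
  then pseq (q zero (suc zero)) (2 ℕ.* k ∸ 1) * q zero j
       + pseq (q zero (suc zero)) (2 ℕ.* k) * q (suc zero) j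
  else q (suc zero) j
bUpper q k i j = q i j

theQuiver : ∀ {m} → (q : Fin (suc (suc m)) → Fin (suc (suc m)) → ℤ) (k : ℕ) →
            Matrix (suc (suc m))
theQuiver q k i j with Fin.compare i j
... | Fin.less _ _    = bUpper q k i j
... | Fin.equal _     = + 0
... | Fin.greater _ _ = - bUpper q k j i

-- The mutation sequence
--   n, (1,2)^k, n-1, n-2, …, 2, 1, (2,1)^k
-- (written 0-based: last, (0,1)^k, n-2, …, 0, (1,0)^k).
theCycle : ∀ {m} → ℕ → List (Fin (suc (suc m)))
theCycle {m} k =
  fromℕ (suc m)
  ∷ concat (replicate k (zero ∷ suc zero ∷ []))
  ++ reverse (map inject₁ (allFin (suc m)))
  ++ concat (replicate k (suc zero ∷ zero ∷ []))

{-# OPTIONS --safe #-}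
module Submission where

-- The exchange matrix restricted to the vertices 1, 2 and one further vertex evolves under
-- alternating mutations at 1 and 2 by a linear recurrence (wind below); following the vertices
-- 3, …, n-1 (unwound while n is wound, and conversely) along the walk shows that it closes up and that
-- all its quivers differ.
--
-- For the last claim, count with sign the passages of a walk through the edge labelled n at Q.
-- The given cycle passes once, so it is enough that no mutation cycle of length ≤ 4k passes at all.
-- From both ends of this edge start paths of 2k mutations at 1, 2, 1, 2, …; any mutation leaving one
-- of these paths creates a fork in the sense of Warkentin, and a walk without backtracking never
-- leaves the forks again. So a mutation cycle through the edge contains both paths, which are
-- disjoint because the arrows between n and 3, …, n-1 point in opposite directions on them.

open import Defs
open import Data.Bool using (Bool; true; false; if_then_else_)
open import Data.Empty using (⊥; ⊥-elim)
open import Data.Fin as Fin using (Fin; zero; suc; toℕ; inject₁; fromℕ)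
import Data.Fin.Properties as FinP
open import Data.Fin.Relation.Unary.Top using (view; ‵fromℕ; ‵inject₁)
open import Data.Integer as ℤ using (ℤ; +_; -[1+_]; -_; ∣_∣; +≤+; +<+)
open import Data.Integer.DivMod using (_/ℕ_)
import Data.Integer.Properties as ℤP
open import Data.Integer.Tactic.RingSolver using (solve-∀)
open import Data.List using (List; []; _∷_; _++_; [_]; length; reverse; map; concat; replicate; allFin; tabulate; take)
import Data.List.Properties as ListP
open import Data.List.Relation.Unary.All as All using (All; []; _∷_)
import Data.List.Relation.Unary.All.Properties as AllP
open import Data.List.Relation.Unary.AllPairs using (AllPairs; []; _∷_)
import Data.List.Relation.Unary.AllPairs.Properties as AllPairsP
open import Data.List.Relation.Unary.Linked using (Linked; []; [-]; _∷_)
open import Data.Nat as ℕ using (ℕ; zero; suc)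
import Data.Nat.DivMod as ℕD
import Data.Nat.Properties as ℕP
import Data.Nat.Tactic.RingSolver as ℕSolver
open import Data.Product using (_×_; _,_; proj₁; proj₂; ∃-syntax)
open import Data.Sum using (_⊎_; inj₁; inj₂; swap) renaming (map to map⊎)
open import Data.Unit using (tt)
open import Function using (_∘_; id)
open import Relation.Binary.Construct.Closure.ReflexiveTransitive using (_◅_) renaming (ε to done)
open import Relation.Binary.Construct.Closure.Symmetric using (fwd; bwd)
open import Relation.Binary.Definitions using (tri<; tri≈; tri>)
open import Relation.Binary.PropositionalEquality using (_≡_; _≢_; refl; sym; trans; cong; cong₂; subst; subst₂; module ≡-Reasoning)
open import Relation.Nullary using (¬_; Dec; yes; no; toSum; does)
open import Relation.Nullary.Decidable using (dec-true; dec-false)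

-- Write K = 2k, let C 0 = Q, and let A 0 be the other end of its edge labelled n. A mutation cycle
-- through this edge consists of it and a walk from A 0 to C 0. As C 0 is not a fork, this walk runs
-- along the whole of A up to A K. Since A K is not a fork either, the rest, read backwards from C
-- 0, runs along the whole of C up to C K, and A K differs from C K, so one more mutation is needed.
-- The cycle therefore has length at least 2K + 2 = 4k + 2. The given walk closes up for the
-- following reason. On C, unlike on A, the first two mutations create arrows from 3, ..., n-1 to n.
-- If C is continued by two steps beyond K, the mutations K + 1 and K + 2 cancel exactly these, and
-- C (K + 2) agrees with A K except that all arrows between a vertex among 3, ..., n-1 and one of 1,
-- 2, n are reversed. Mutating n-1, ..., 3 in descending order, each vertex being a sink at its
-- turn, performs this reversal. The letters 2, 1 at the end of the descent are then the first two
-- steps back along C.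

module _ where

  open import Data.Integer using (_+_; _*_; _-_; _≤_; _<_)

  -- The correction term of the mutation rule, and inequalities between weights.

  half : ℤ → ℤ → ℤ
  half x y = (+ ∣ x ∣ * y + x * + ∣ y ∣) /ℕ 2

  n+n≡n*2 : ∀ n → n ℕ.+ n ≡ n ℕ.* 2
  n+n≡n*2 n = trans (cong (n ℕ.+_) (sym (ℕP.+-identityʳ n))) (ℕP.*-comm 2 n)

  -- Integer division rounds down, which for a negative dividend makes a nonzero remainder a
  -- separate case; the mutation rule only halves even numbers.
  -[1+]/2 : ∀ m → suc m ℕ.% 2 ≡ 0 → -[1+ m ] /ℕ 2 ≡ - (+ (suc m ℕ./ 2))
  -[1+]/2 m e with suc m ℕ.% 2
  -[1+]/2 m refl | zero = refl

  double/2 : ∀ z → (z + z) /ℕ 2 ≡ z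
  double/2 (+ n)    = cong +_ (trans (cong (ℕ._/ 2) (n+n≡n*2 n)) (ℕD.m*n/n≡m n 2))
  double/2 -[1+ n ] = trans (-[1+]/2 (suc (n ℕ.+ n)) (trans (cong (ℕ._% 2) e) (ℕD.m*n%n≡0 (suc n) 2)))
                            (cong (λ m → - (+ m)) (trans (cong (ℕ._/ 2) e) (ℕD.m*n/n≡m (suc n) 2)))
    where
    e : suc (suc (n ℕ.+ n)) ≡ suc n ℕ.* 2
    e = cong (λ m → suc (suc m)) (n+n≡n*2 n)

  +∣i∣≡-i : ∀ {i} → i ≤ + 0 → + ∣ i ∣ ≡ - i
  +∣i∣≡-i {i} i≤0 = trans (cong +_ (sym (ℤP.∣-i∣≡∣i∣ i))) (ℤP.0≤i⇒+∣i∣≡i (ℤP.neg-mono-≤ i≤0))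

  half-comm : ∀ x y → half x y ≡ half y x
  half-comm x y = cong (_/ℕ 2) (trans (ℤP.+-comm (+ ∣ x ∣ * y) (x * + ∣ y ∣))
    (cong₂ ℤ._+_ (ℤP.*-comm x (+ ∣ y ∣)) (ℤP.*-comm (+ ∣ x ∣) y)))

  half-via : ∀ {x y a b} → + ∣ x ∣ ≡ a → + ∣ y ∣ ≡ b → half x y ≡ (a * y + x * b) /ℕ 2
  half-via {x} {y} p q = cong₂ (λ a b → (a * y + x * b) /ℕ 2) p q

  half-≥≥ : ∀ {x y} → + 0 ≤ x → + 0 ≤ y → half x y ≡ x * y
  half-≥≥ {x} {y} p q = trans (half-via {x} {y} (ℤP.0≤i⇒+∣i∣≡i p) (ℤP.0≤i⇒+∣i∣≡i q)) (double/2 (x * y))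

  half-≥≤ : ∀ {x y} → + 0 ≤ x → y ≤ + 0 → half x y ≡ + 0
  half-≥≤ {x} {y} p q = trans (half-via {x} {y} (ℤP.0≤i⇒+∣i∣≡i p) (+∣i∣≡-i q)) (cong (_/ℕ 2) (cancel x y))
    where
    cancel : ∀ x y → x * y + x * - y ≡ + 0
    cancel = solve-∀

  half-≤≥ : ∀ {x y} → x ≤ + 0 → + 0 ≤ y → half x y ≡ + 0
  half-≤≥ {x} {y} p q = trans (half-comm x y) (half-≥≤ q p)

  half-neg : ∀ x y → half (- x) (- y) ≡ - half x y
  half-≤≤ : ∀ {x y} → x ≤ + 0 → y ≤ + 0 → half x y ≡ - (x * y)
  half-≤≤ {x} {y} p q = trans (half-via {x} {y} (+∣i∣≡-i p) (+∣i∣≡-i q)) (trans (cong (_/ℕ 2) (shape x y)) (double/2 (- (x * y))))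
    where
    shape : ∀ x y → - x * y + x * - y ≡ - (x * y) + - (x * y)
    shape = solve-∀

  half-neg x y with ℤP.≤-total (+ 0) x | ℤP.≤-total (+ 0) y
  ... | inj₁ p | inj₁ q = trans (half-≤≤ (ℤP.neg-mono-≤ p) (ℤP.neg-mono-≤ q)) (trans (sq x y) (cong -_ (sym (half-≥≥ p q))))
    where
    sq : ∀ x y → - (- x * - y) ≡ - (x * y)
    sq = solve-∀
  ... | inj₁ p | inj₂ q = trans (half-≤≥ (ℤP.neg-mono-≤ p) (ℤP.neg-mono-≤ q)) (cong -_ (sym (half-≥≤ p q)))
  ... | inj₂ p | inj₁ q = trans (half-≥≤ (ℤP.neg-mono-≤ p) (ℤP.neg-mono-≤ q)) (cong -_ (sym (half-≤≥ p q)))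
  ... | inj₂ p | inj₂ q = trans (half-≥≥ (ℤP.neg-mono-≤ p) (ℤP.neg-mono-≤ q)) (trans (sq x y) (cong -_ (sym (half-≤≤ p q))))
    where
    sq : ∀ x y → - x * - y ≡ - - (x * y)
    sq = solve-∀

  i≡-i⇒i≡0 : ∀ {i} → i ≡ - i → i ≡ + 0
  i≡-i⇒i≡0 {+ zero} e = refl

  2≤⇒0≤ : ∀ {x} → + 2 ≤ x → + 0 ≤ x
  2≤⇒0≤ = ℤP.≤-trans (+≤+ ℕ.z≤n)

  2≤⇒-≤0 : ∀ {x} → + 2 ≤ x → - x ≤ + 0
  2≤⇒-≤0 p = ℤP.neg-mono-≤ (2≤⇒0≤ p)

  ≤-< : ∀ {x y} → x ≤ + 0 → + 2 ≤ y → x < y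
  ≤-< p q = ℤP.≤-<-trans p (ℤP.<-≤-trans (+<+ (ℕ.s≤s ℕ.z≤n)) q)

  b≤bc-b : ∀ {b c} → + 2 ≤ b → + 2 ≤ c → b ≤ b * c - b
  b≤bc-b {b} {c} 2≤b 2≤c = begin
    b                   ≡⟨ e b ⟩
    b * + 2 - b     ≤⟨ ℤP.+-monoˡ-≤ (- b) (ℤP.*-monoˡ-≤-nonNeg b {{ℤ.nonNegative (2≤⇒0≤ 2≤b)}} 2≤c) ⟩
    b * c - b       ∎
    where
    open ℤP.≤-Reasoning
    e : ∀ b → b ≡ b * + 2 - b
    e = solve-∀

  -- Comes from `b c - b - c = (b - 1) (c - 1) - 1`, where both factors are at least 1.
  c≤bc-b : ∀ {b c} → + 2 ≤ b → + 2 ≤ c → c ≤ b * c - b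
  c≤bc-b {b} {c} 2≤b 2≤c = begin
    c                                                 ≡⟨ ℤP.+-identityʳ c ⟨
    c + + 0                                         ≤⟨ ℤP.+-monoʳ-≤ c pos ⟩
    c + ((b - + 1) * (c - + 1) - + 1)       ≡⟨ e b c ⟩
    b * c - b                                     ∎
    where
    open ℤP.≤-Reasoning
    e : ∀ b c → c + ((b - + 1) * (c - + 1) - + 1) ≡ b * c - b
    e = solve-∀
    1≤c-1 : + 1 ≤ c - + 1
    1≤c-1 = ℤP.+-monoˡ-≤ (- + 1) 2≤c
    1≤b-1 : + 1 ≤ b - + 1
    1≤b-1 = ℤP.+-monoˡ-≤ (- + 1) 2≤b
    pos : + 0 ≤ (b - + 1) * (c - + 1) - + 1
    pos = ℤP.+-monoˡ-≤ (- + 1) (ℤP.≤-trans 1≤c-1 (subst (ℤ._≤ (b - + 1) * (c - + 1)) (ℤP.*-identityˡ (c - + 1))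
            (ℤP.*-monoʳ-≤-nonNeg (c - + 1) {{ℤ.nonNegative (ℤP.≤-trans (+≤+ ℕ.z≤n) 1≤c-1)}} 1≤b-1)))

  -- Here `b` and `c` are the weights along a path of length two and `y` is the weight of the arrow
  -- closing it to a triangle. If, say, `y < b`, then `b c - y` exceeds `b c - b`, which is at least
  -- `b` and at least `c`. So the new arrow outweighs both even after cancelling the old one.
  heavy-sum : ∀ {x y b c} → + 2 ≤ b → + 2 ≤ c → x ≡ - y → y < b ⊎ y < c →
              b < x + b * c × c < x + b * c
  heavy-sum {x} {y} {b} {c} 2≤b 2≤c refl (inj₁ y<b) =
      ℤP.≤-<-trans (b≤bc-b 2≤b 2≤c) below , ℤP.≤-<-trans (c≤bc-b 2≤b 2≤c) below
    where
    below : b * c - b < - y + b * c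
    below = subst (ℤ._< - y + b * c) (ℤP.+-comm (- b) _) (ℤP.+-monoˡ-< (b * c) (ℤP.neg-mono-< y<b))
  heavy-sum {x} {y} {b} {c} 2≤b 2≤c refl (inj₂ y<c) =
    let p , q = heavy-sum {b = c} {c = b} 2≤c 2≤b refl (inj₁ y<c)
        e = cong (λ z → - y + z) (ℤP.*-comm c b)
    in subst (b <_) e q , subst (c <_) e p

  -- Mutation of skew-symmetric matrices, and forks.

  module _ {n : ℕ} where

    _≟⊎_ : (i k : Fin n) → i ≡ k ⊎ i ≢ k
    i ≟⊎ k = toSum (i Fin.≟ k)

    μ-row : ∀ (k : Fin n) X j → μ k X k j ≡ - X k j
    μ-row k X j with k Fin.≟ k
    ... | yes _ = refl
    ... | no ne = ⊥-elim (ne refl)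

    μ-col : ∀ (k : Fin n) X i → μ k X i k ≡ - X i k
    μ-col k X i with i Fin.≟ k
    ... | yes _ = refl
    ... | no _ with k Fin.≟ k
    ...   | yes _ = refl
    ...   | no ne = ⊥-elim (ne refl)

    μ-off : ∀ {k i j : Fin n} X → i ≢ k → j ≢ k → μ k X i j ≡ X i j + half (X i k) (X k j)
    μ-off {k} {i} {j} X i≢k j≢k with i Fin.≟ k | j Fin.≟ k
    ... | yes e | _     = ⊥-elim (i≢k e)
    ... | no _  | yes e = ⊥-elim (j≢k e)
    ... | no _  | no _  = refl

    ≈-refl : {X : Matrix n} → X ≈Q X
    ≈-refl i j = refl

    ≈-sym : {X Y : Matrix n} → X ≈Q Y → Y ≈Q X
    ≈-sym e i j = sym (e i j)

    ≈-trans : {X Y Z : Matrix n} → X ≈Q Y → Y ≈Q Z → X ≈Q Z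
    ≈-trans e f i j = trans (e i j) (f i j)

    μ-cong : ∀ k {X Y : Matrix n} → X ≈Q Y → μ k X ≈Q μ k Y
    μ-cong k e i j rewrite e i j | e i k | e k j = refl

    μ-involutive : ∀ k (X : Matrix n) → μ k (μ k X) ≈Q X
    μ-involutive k X i j with i ≟⊎ k
    ... | inj₁ refl = trans (μ-row k (μ k X) j) (trans (cong -_ (μ-row k X j)) (ℤP.neg-involutive _))
    ... | inj₂ i≢k with j ≟⊎ k
    ...   | inj₁ refl = trans (μ-col k (μ k X) i) (trans (cong -_ (μ-col k X i)) (ℤP.neg-involutive _))
    ...   | inj₂ j≢k = begin
      μ k (μ k X) i j                                            ≡⟨ μ-off (μ k X) i≢k j≢k ⟩
      μ k X i j + half (μ k X i k) (μ k X k j)                 ≡⟨ cong₂ ℤ._+_ (μ-off X i≢k j≢k) (cong₂ half (μ-col k X i) (μ-row k X j)) ⟩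
      (X i j + half (X i k) (X k j)) + half (- X i k) (- X k j) ≡⟨ cong (λ z → (X i j + half (X i k) (X k j)) + z) (half-neg (X i k) (X k j)) ⟩
      (X i j + half (X i k) (X k j)) + - half (X i k) (X k j)   ≡⟨ cancel (X i j) (half (X i k) (X k j)) ⟩
      X i j                                                      ∎
      where
      open ≡-Reasoning
      cancel : ∀ x y → (x + y) + - y ≡ x
      cancel = solve-∀

    Skew : Matrix n → Set
    Skew X = ∀ i j → X j i ≡ - X i j

    μ-skew : ∀ k {X} → Skew X → Skew (μ k X)
    μ-skew k {X} sk i j with i ≟⊎ k
    ... | inj₁ refl = trans (μ-col k X j) (trans (cong -_ (sk k j)) (cong -_ (sym (μ-row k X j))))
    ... | inj₂ i≢k with j ≟⊎ k
    ...   | inj₁ refl = trans (μ-row k X i) (trans (cong -_ (sk i k)) (cong -_ (sym (μ-col k X i))))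
    ...   | inj₂ j≢k = begin
      μ k X j i                           ≡⟨ μ-off X j≢k i≢k ⟩
      X j i + half (X j k) (X k i)      ≡⟨ cong₂ ℤ._+_ (sk i j) (cong₂ half (sk k j) (sk i k)) ⟩
      - X i j + half (- X k j) (- X i k) ≡⟨ cong (λ z → - X i j + z) (trans (half-neg (X k j) (X i k)) (cong -_ (half-comm (X k j) (X i k)))) ⟩
      - X i j + - half (X i k) (X k j)  ≡⟨ ℤP.neg-distrib-+ (X i j) _ ⟨
      - (X i j + half (X i k) (X k j))  ≡⟨ cong -_ (μ-off X i≢k j≢k) ⟨
      - μ k X i j                         ∎
      where open ≡-Reasoning

    skew-antisym : ∀ {X} → Skew X → ∀ {i j} → + 2 ≤ X i j → + 2 ≤ X j i → ⊥
    skew-antisym {X} sk {i} {j} p q = ℤP.<-irrefl refl (≤-< (subst (ℤ._≤ + 0) (sym (sk i j)) (2≤⇒-≤0 p)) q)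

    skew-≤0 : ∀ {X} → Skew X → ∀ {i j} → + 2 ≤ X i j → X j i ≤ + 0
    skew-≤0 sk {i} {j} p = subst (ℤ._≤ + 0) (sym (sk i j)) (2≤⇒-≤0 p)

    Abundant : Matrix n → Set
    Abundant X = ∀ {i j} → i ≢ j → + 2 ≤ X i j ⊎ + 2 ≤ X j i

    -- Warkentin's forks with point of return r, except that acyclic quivers with
    -- source or sink r are admitted too.
    record Fork (r : Fin n) (X : Matrix n) : Set where
      field
        skew     : Skew X
        abundant : Abundant X
        acyclic  : ∀ {a b c} → a ≢ r → b ≢ r → c ≢ r →
                   + 2 ≤ X a b → + 2 ≤ X b c → + 2 ≤ X c a → ⊥
        heavy    : ∀ {i j} → + 2 ≤ X i r → + 2 ≤ X r j → X i r < X j i × X r j < X j i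

    -- The condition under which mutation at v produces a fork with point of return v.
    record PreFork (v : Fin n) (X : Matrix n) : Set where
      field
        skew       : Skew X
        abundant   : Abundant X
        acyclicIn  : ∀ {a b c} → + 2 ≤ X a v → + 2 ≤ X b v → + 2 ≤ X c v →
                     + 2 ≤ X a b → + 2 ≤ X b c → + 2 ≤ X c a → ⊥
        acyclicOut : ∀ {a b c} → + 2 ≤ X v a → + 2 ≤ X v b → + 2 ≤ X v c →
                     + 2 ≤ X a b → + 2 ≤ X b c → + 2 ≤ X c a → ⊥
        light      : ∀ {i j} → + 2 ≤ X i v → + 2 ≤ X v j → X j i < X i v ⊎ X j i < X v j

    -- Mutation keeps the arrows among the predecessors of `v` and those among its successors.
    -- Between the two sets, `light` and `heavy-sum` make all arrows go from predecessors to
    -- successors afterwards. An oriented triangle avoiding `v` would therefore stay inside one of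
    -- the sets, which `acyclicIn` and `acyclicOut` forbid.
    PreFork⇒Fork : ∀ {v X} → PreFork v X → Fork v (μ v X)
    PreFork⇒Fork {v} {X} pf = record { skew = skew' ; abundant = abundant' ; acyclic = acyclic' ; heavy = heavy' }
      where
      open PreFork pf
      X' = μ v X
      skew' = μ-skew v skew

      ≢v : ∀ {i} → + 2 ≤ X i v → i ≢ v
      ≢v p refl = skew-antisym skew p p
      ≢v' : ∀ {i} → + 2 ≤ X v i → i ≢ v
      ≢v' p refl = skew-antisym skew p p

      inIn : ∀ {i j} → + 2 ≤ X i v → + 2 ≤ X j v → X' i j ≡ X i j
      inIn p q = trans (μ-off X (≢v p) (≢v q)) (trans (cong (λ z → X _ _ + z) (half-≥≤ (2≤⇒0≤ p) (skew-≤0 skew q))) (ℤP.+-identityʳ _))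
      outOut : ∀ {i j} → + 2 ≤ X v i → + 2 ≤ X v j → X' i j ≡ X i j
      outOut p q = trans (μ-off X (≢v' p) (≢v' q)) (trans (cong (λ z → X _ _ + z) (half-≤≥ (skew-≤0 skew p) (2≤⇒0≤ q))) (ℤP.+-identityʳ _))
      inOut : ∀ {i j} → + 2 ≤ X i v → + 2 ≤ X v j → X i v < X' i j × X v j < X' i j
      inOut {i} {j} p q =
        subst (λ z → X i v < z × X v j < z)
          (sym (trans (μ-off X (≢v p) (≢v' q)) (cong (λ z → X _ _ + z) (half-≥≥ (2≤⇒0≤ p) (2≤⇒0≤ q)))))
          (heavy-sum p q (skew j i) (light p q))

      cross : ∀ {i j} → + 2 ≤ X i v → + 2 ≤ X v j → + 2 ≤ X' j i → ⊥
      cross {i} {j} p q r = skew-antisym {X'} skew' {i} {j} (ℤP.<⇒≤ (ℤP.≤-<-trans p (proj₁ (inOut p q)))) r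

      abundant' : Abundant X'
      abundant' {i} {j} i≢j with i ≟⊎ v | j ≟⊎ v
      ... | inj₁ refl | inj₁ refl = ⊥-elim (i≢j refl)
      ... | inj₁ refl | inj₂ _ with abundant i≢j
      ...   | inj₁ p = inj₂ (subst (+ 2 ≤_) (trans (skew j v) (sym (μ-col v X j))) p)
      ...   | inj₂ p = inj₁ (subst (+ 2 ≤_) (trans (skew v j) (sym (μ-row v X j))) p)
      abundant' {i} {j} i≢j | inj₂ _ | inj₁ refl with abundant i≢j
      ...   | inj₁ p = inj₂ (subst (+ 2 ≤_) (trans (skew v i) (sym (μ-row v X i))) p)
      ...   | inj₂ p = inj₁ (subst (+ 2 ≤_) (trans (skew i v) (sym (μ-col v X i))) p)
      abundant' {i} {j} i≢j | inj₂ i≢v | inj₂ j≢v with abundant i≢v | abundant j≢v | abundant i≢j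
      ... | inj₁ p | inj₁ q | inj₁ r = inj₁ (subst (+ 2 ≤_) (sym (inIn p q)) r)
      ... | inj₁ p | inj₁ q | inj₂ r = inj₂ (subst (+ 2 ≤_) (sym (inIn q p)) r)
      ... | inj₂ p | inj₂ q | inj₁ r = inj₁ (subst (+ 2 ≤_) (sym (outOut p q)) r)
      ... | inj₂ p | inj₂ q | inj₂ r = inj₂ (subst (+ 2 ≤_) (sym (outOut q p)) r)
      ... | inj₁ p | inj₂ q | _ = inj₁ (ℤP.<⇒≤ (ℤP.≤-<-trans p (proj₁ (inOut p q))))
      ... | inj₂ p | inj₁ q | _ = inj₂ (ℤP.<⇒≤ (ℤP.≤-<-trans q (proj₁ (inOut q p))))

      acyclic' : ∀ {a b c} → a ≢ v → b ≢ v → c ≢ v →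
                 + 2 ≤ X' a b → + 2 ≤ X' b c → + 2 ≤ X' c a → ⊥
      acyclic' a≢v b≢v c≢v ab bc ca with abundant a≢v | abundant b≢v | abundant c≢v
      ... | inj₁ a | inj₁ b | inj₁ c = acyclicIn a b c (subst (+ 2 ≤_) (inIn a b) ab) (subst (+ 2 ≤_) (inIn b c) bc) (subst (+ 2 ≤_) (inIn c a) ca)
      ... | inj₂ a | inj₂ b | inj₂ c = acyclicOut a b c (subst (+ 2 ≤_) (outOut a b) ab) (subst (+ 2 ≤_) (outOut b c) bc) (subst (+ 2 ≤_) (outOut c a) ca)
      ... | inj₂ a | inj₁ b | _      = cross b a ab
      ... | _      | inj₂ b | inj₁ c = cross c b bc
      ... | inj₁ a | _      | inj₂ c = cross a c ca

      heavy' : ∀ {i j} → + 2 ≤ X' i v → + 2 ≤ X' v j → X' i v < X' j i × X' v j < X' j i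
      heavy' {i} {j} p q =
        -- The arrows at `v` are reversed by the mutation, so the path through `v` from `i` to `j`
        -- was one from `j` to `i` before.
        let ei = trans (μ-col v X i) (sym (skew i v))
            ej = trans (μ-row v X j) (sym (skew v j))
            r , s = inOut (subst (+ 2 ≤_) ej q) (subst (+ 2 ≤_) ei p)
        in subst (ℤ._< X' j i) (sym ei) s , subst (ℤ._< X' j i) (sym ej) r

    -- Every oriented triangle passes through `r`. If one consists of predecessors of `v`, then its
    -- vertex before `r`, with `r` and `v`, is a path through `r`, and `heavy` yields an arrow from
    -- `v` back to a predecessor; dually for successors. A triangle through `v` also contains `r`,
    -- and its heaviest side, the one opposite `r`, ends at `v`, which gives `light`.
    Fork⇒PreFork : ∀ {r v X} → Fork r X → v ≢ r → PreFork v X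
    Fork⇒PreFork {r} {v} {X} fk v≢r = record { skew = skew ; abundant = abundant ; acyclicIn = aIn ; acyclicOut = aOut ; light = light' }
      where
      open Fork fk
      aIn : ∀ {a b c} → + 2 ≤ X a v → + 2 ≤ X b v → + 2 ≤ X c v →
            + 2 ≤ X a b → + 2 ≤ X b c → + 2 ≤ X c a → ⊥
      throughIn : ∀ {c} → + 2 ≤ X r v → + 2 ≤ X c v → + 2 ≤ X c r → ⊥
      throughIn p q s = skew-antisym skew q (ℤP.<⇒≤ (ℤP.≤-<-trans p (proj₂ (heavy s p))))
      aIn {a} {b} {c} p q s ab bc ca with a ≟⊎ r | b ≟⊎ r | c ≟⊎ r
      ... | inj₁ refl | _ | _ = throughIn p s ca
      ... | inj₂ _ | inj₁ refl | _ = throughIn q p ab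
      ... | inj₂ _ | inj₂ _ | inj₁ refl = throughIn s q bc
      ... | inj₂ x | inj₂ y | inj₂ z = acyclic x y z ab bc ca
      aOut : ∀ {a b c} → + 2 ≤ X v a → + 2 ≤ X v b → + 2 ≤ X v c →
            + 2 ≤ X a b → + 2 ≤ X b c → + 2 ≤ X c a → ⊥
      throughOut : ∀ {b} → + 2 ≤ X v r → + 2 ≤ X v b → + 2 ≤ X r b → ⊥
      throughOut p q s = skew-antisym skew q (ℤP.<⇒≤ (ℤP.≤-<-trans p (proj₁ (heavy p s))))
      aOut {a} {b} {c} p q s ab bc ca with a ≟⊎ r | b ≟⊎ r | c ≟⊎ r
      ... | inj₁ refl | _ | _ = throughOut p q ab
      ... | inj₂ _ | inj₁ refl | _ = throughOut q s bc
      ... | inj₂ _ | inj₂ _ | inj₁ refl = throughOut s p ca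
      ... | inj₂ x | inj₂ y | inj₂ z = acyclic x y z ab bc ca
      light' : ∀ {i j} → + 2 ≤ X i v → + 2 ≤ X v j → X j i < X i v ⊎ X j i < X v j
      light' {i} {j} p q with abundant {i} {j} (λ { refl → skew-antisym skew p q })
      ... | inj₁ ij = inj₁ (≤-< (skew-≤0 skew ij) p)
      ... | inj₂ ji with i ≟⊎ r | j ≟⊎ r
      ...   | inj₁ refl | _ = inj₂ (proj₁ (heavy ji p))
      ...   | inj₂ _ | inj₁ refl = inj₁ (proj₂ (heavy q ji))
      ...   | inj₂ x | inj₂ y = ⊥-elim (acyclic x v≢r y p q ji)

  -- Words without equal neighbours, and the walks they describe.

  module _ {A : Set} where

    linked-tail : ∀ {x : A} {xs} → Linked _≢_ (x ∷ xs) → Linked _≢_ xs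
    linked-tail [-]     = []
    linked-tail (_ ∷ l) = l

    linked-prefix : ∀ (xs : List A) {ys} → Linked _≢_ (xs ++ ys) → Linked _≢_ xs
    linked-prefix []           _       = []
    linked-prefix (x ∷ [])     _       = [-]
    linked-prefix (x ∷ y ∷ xs) (r ∷ l) = r ∷ linked-prefix (y ∷ xs) l

    linked-suffix : ∀ (xs : List A) {ys} → Linked _≢_ (xs ++ ys) → Linked _≢_ ys
    linked-suffix []       l = l
    linked-suffix (x ∷ xs) l = linked-suffix xs (linked-tail l)

    linked-glue : ∀ (xs : List A) {y ys} → Linked _≢_ (xs ++ [ y ]) → Linked _≢_ (y ∷ ys) → Linked _≢_ (xs ++ y ∷ ys)
    linked-glue []           _       l = l
    linked-glue (x ∷ [])     (r ∷ _) l = r ∷ l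
    linked-glue (x ∷ z ∷ xs) (r ∷ k) l = r ∷ linked-glue (z ∷ xs) k l

    linked-cut : ∀ (xs : List A) {y ys} → Linked _≢_ (xs ++ y ∷ ys) → Linked _≢_ (xs ++ [ y ])
    linked-cut []           l       = [-]
    linked-cut (x ∷ [])     (r ∷ l) = r ∷ [-]
    linked-cut (x ∷ z ∷ xs) (r ∷ l) = r ∷ linked-cut (z ∷ xs) l

    linked-reverse : ∀ (xs : List A) → Linked _≢_ xs → Linked _≢_ (reverse xs)
    linked-reverse []           _       = []
    linked-reverse (x ∷ [])     _       = [-]
    linked-reverse (x ∷ y ∷ xs) (r ∷ l)
      rewrite ListP.unfold-reverse x (y ∷ xs) | ListP.unfold-reverse y xs | ListP.++-assoc (reverse xs) [ y ] [ x ]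
      = linked-glue (reverse xs)
          (subst (Linked _≢_) (ListP.unfold-reverse y xs) (linked-reverse (y ∷ xs) l)) ((r ∘ sym) ∷ [-])

  module _ {n : ℕ} where

    -- Rebases a cycle at one of its passages of an edge labelled `i`: the rest `v ++ u` joins the
    -- two ends of this edge and neither starts nor ends with `i`.
    rotate : ∀ (u : List (Fin n)) i v → CyclicallyDistinct (u ++ i ∷ v) → Linked _≢_ (i ∷ (v ++ u) ++ [ i ])
    rotate []      i v l rewrite ListP.++-identityʳ v = l
    rotate (x ∷ u) i v l rewrite ListP.++-assoc (x ∷ u) (i ∷ v) [ x ] | ListP.++-assoc v (x ∷ u) [ i ] =
      linked-glue (i ∷ v) (linked-suffix (x ∷ u) l) (linked-cut (x ∷ u) l)

    mutSeq-++ : ∀ (X : Matrix n) u v → mutSeq X (u ++ v) ≡ mutSeq (mutSeq X u) v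
    mutSeq-++ X []      v = refl
    mutSeq-++ X (i ∷ u) v = mutSeq-++ (μ i X) u v

    mutSeq-cong : ∀ {X Y : Matrix n} w → X ≈Q Y → mutSeq X w ≈Q mutSeq Y w
    mutSeq-cong []      e = e
    mutSeq-cong (i ∷ w) e = mutSeq-cong w (μ-cong i e)

    mutSeq-reverse : ∀ (X : Matrix n) w → mutSeq (mutSeq X w) (reverse w) ≈Q X
    mutSeq-reverse X []      = ≈-refl {X = X}
    mutSeq-reverse X (i ∷ w)
      rewrite ListP.unfold-reverse i w | mutSeq-++ (mutSeq (μ i X) w) (reverse w) [ i ] =
      ≈-trans {Y = μ i (μ i X)} (μ-cong i (mutSeq-reverse (μ i X) w)) (μ-involutive i X)

    mutSeq-back : ∀ {X Y : Matrix n} w → mutSeq X w ≈Q Y → mutSeq Y (reverse w) ≈Q X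
    mutSeq-back {X} {Y} w e = ≈-trans {Y = mutSeq (mutSeq X w) (reverse w)}
      (mutSeq-cong (reverse w) (≈-sym {X = mutSeq X w} e)) (mutSeq-reverse X w)

    Fork-cong : ∀ {r} {X Y : Matrix n} → X ≈Q Y → Fork r X → Fork r Y
    Fork-cong {r} {X} {Y} e f = record
      { skew     = λ i j → trans (sym (e j i)) (trans (skew i j) (cong -_ (e i j)))
      ; abundant = λ {i} {j} ne → subst₂ (λ a b → + 2 ≤ a ⊎ + 2 ≤ b) (e i j) (e j i) (abundant ne)
      ; acyclic  = λ {a} {b} {c} p q r ab bc ca → acyclic p q r (back a b ab) (back b c bc) (back c a ca)
      ; heavy    = λ {i} {j} p q → subst₂ _×_ (cong₂ _<_ (e i r) (e j i)) (cong₂ _<_ (e r j) (e j i))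
                                     (heavy (back i r p) (back r j q))
      }
      where
      open Fork f
      back : ∀ i j → + 2 ≤ Y i j → + 2 ≤ X i j
      back i j = subst (+ 2 ≤_) (sym (e i j))

    fork-persists : ∀ {r} {X : Matrix n} w → Fork r X → Linked _≢_ (r ∷ w) → ∃[ s ] Fork s (mutSeq X w)
    fork-persists []      f l       = _ , f
    fork-persists (i ∷ w) f (r ∷ l) = fork-persists w (PreFork⇒Fork (Fork⇒PreFork f (r ∘ sym))) l

    NotFork : Matrix n → Set
    NotFork X = ∀ r → ¬ Fork r X

    _≟Q_ : (X Y : Matrix n) → Dec (X ≈Q Y)
    X ≟Q Y = FinP.all? λ i → FinP.all? λ j → X i j ℤ.≟ Y i j

  -- Walks that are forced to follow a path.

  module Forced {n : ℕ} (ℓ : Fin n) (lab : ℕ → Fin n) (K : ℕ) where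

    previous : ℕ → Fin n
    previous zero    = ℓ
    previous (suc t) = lab t

    -- At each of the quivers `D 0`, ..., `D (K - 1)` every mutation that neither advances nor goes
    -- back leads to a fork. Going back from `D 0` means crossing the edge `ℓ`, hence
    -- `previous zero`.
    record Tunnel (D : ℕ → Matrix n) : Set where
      field
        next : ∀ t → D (suc t) ≡ μ (lab t) (D t)
        exit : ∀ {t v} → t ℕ.< K → v ≢ lab t → v ≢ previous t → PreFork v (D t)

    module _ {D : ℕ → Matrix n} (T : Tunnel D) where
      open Tunnel T

      -- Any deviation before `D K` would make the final quiver a fork by `fork-persists`. The word
      -- `z` is what follows `w`; carrying it along preserves the information that the remaining
      -- walk does not end with the letter after it.
      forced : ∀ r {t} → t ℕ.+ r ≡ K → ∀ w z → Linked _≢_ (previous t ∷ w ++ z) → NotFork (mutSeq (D t) w) →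
        (∃[ s ] s ℕ.≤ K × mutSeq (D t) w ≡ D s) ⊎
        (∃[ w₂ ] length w ≡ r ℕ.+ length w₂ × Linked _≢_ (w₂ ++ z) × mutSeq (D t) w ≡ mutSeq (D K) w₂)
      forced r {t} e []      z l nf = inj₁ (t , ℕP.m+n≤o⇒m≤o t (ℕP.≤-reflexive e) , refl)
      forced zero {t} e (i ∷ w) z l nf = inj₂ (i ∷ w , refl , linked-tail l ,
        cong (λ s → mutSeq (D s) (i ∷ w)) (trans (sym (ℕP.+-identityʳ t)) e))
      forced (suc r) {t} e (i ∷ w) z (ne ∷ l) nf with i ≟⊎ lab t
      ... | inj₂ i≢ = ⊥-elim (nf _ (proj₂ (fork-persists w
                        (PreFork⇒Fork (exit (ℕP.m+n≤o⇒m≤o (suc t) (ℕP.≤-reflexive (trans (sym (ℕP.+-suc t r)) e))) i≢ (ne ∘ sym)))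
                        (linked-prefix (i ∷ w) l))))
      ... | inj₁ refl with forced r {suc t} (trans (sym (ℕP.+-suc t r)) e) w z l
                            (subst (λ Y → NotFork (mutSeq Y w)) (sym (next t)) nf)
      ...   | inj₁ (s , s≤K , p) = inj₁ (s , s≤K , trans (cong (λ Y → mutSeq Y w) (sym (next t))) p)
      ...   | inj₂ (w₂ , len , l₂ , p) = inj₂ (w₂ , cong suc len , l₂ , trans (cong (λ Y → mutSeq Y w) (sym (next t))) p)

    module _ {A C : ℕ → Matrix n} (TA : Tunnel A) (TC : Tunnel C)
             (C₀-notFork : NotFork (C 0)) (A-notFork : NotFork (A K))
             (disjoint : ∀ {s t} → s ℕ.≤ K → t ℕ.≤ K → ¬ A s ≈Q C t) where

      -- The tunnel `A` takes up the first `K` letters. The remaining word, reversed, starts at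
      -- `C 0` with a letter other than `ℓ`, because `w` did not end with `ℓ`; so the tunnel `C`
      -- applies to it and takes up another `K` letters.
      connecting-length : ∀ w → Linked _≢_ (ℓ ∷ w ++ [ ℓ ]) → mutSeq (A 0) w ≈Q C 0 → K ℕ.+ suc K ℕ.≤ length w
      connecting-length w l e with forced TA K refl w [ ℓ ] l (λ r f → C₀-notFork r (Fork-cong e f))
      ... | inj₁ (s , s≤K , p) = ⊥-elim (disjoint s≤K ℕ.z≤n (subst (_≈Q C 0) p e))
      ... | inj₂ (w₂ , len , l₂ , p) = subst (K ℕ.+ suc K ℕ.≤_) (sym len) (ℕP.+-monoʳ-≤ K second-half)
        where
        linked : Linked _≢_ (ℓ ∷ reverse w₂ ++ [])
        linked = subst (Linked _≢_) (trans (ListP.reverse-++ w₂ [ ℓ ]) (cong (ℓ ∷_) (sym (ListP.++-identityʳ (reverse w₂)))))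
                   (linked-reverse (w₂ ++ [ ℓ ]) l₂)
        back : mutSeq (C 0) (reverse w₂) ≈Q A K
        back = mutSeq-back {X = A K} w₂ (subst (_≈Q C 0) p e)
        second-half : suc K ℕ.≤ length w₂
        second-half with forced TC K refl (reverse w₂) [] linked (λ r f → A-notFork r (Fork-cong back f))
        ... | inj₁ (s , s≤K , q) = ⊥-elim (disjoint ℕP.≤-refl s≤K (≈-sym {X = C s} (subst (_≈Q A K) q back)))
        -- Exactly `K` letters would end at `C K`, which is not on the other path; this accounts for
        -- the extra 1 in `suc K`.
        ... | inj₂ ([] , _ , _ , q) = ⊥-elim (disjoint ℕP.≤-refl ℕP.≤-refl (≈-sym {X = C K} (subst (_≈Q A K) q back)))
        ... | inj₂ (i ∷ w₃ , len₃ , _ , _) = subst (suc K ℕ.≤_) (trans (sym len₃) (ListP.length-reverse w₂))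
                (subst (suc K ℕ.≤_) (sym (ℕP.+-suc K (length w₃))) (ℕ.s≤s (ℕP.m≤m+n K (length w₃))))

  -- Signed passages through an edge as an obstruction to paving.

  module Crossing {n : ℕ} (ℓ : Fin n) (C : Matrix n) (proper : ¬ C ≈Q μ ℓ C) where

    private
      C' : Matrix n
      C' = μ ℓ C

    -- The sign of a passage is read off from the quiver at which it starts: +1 when leaving `C`, -1
    -- when leaving `C'`. The edge is not a loop by `proper`, so the two cases exclude each other.
    endpoint : Matrix n → ℤ
    endpoint X = if does (X ≟Q C) then + 1 else (if does (X ≟Q C') then - + 1 else + 0)

    passage : Matrix n → Fin n → ℤ
    passage X i = if does (i Fin.≟ ℓ) then endpoint X else + 0

    passages : Matrix n → List (Fin n) → ℤ
    passages X []      = + 0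
    passages X (i ∷ w) = passage X i + passages (μ i X) w

    endpoint-C : ∀ {X} → X ≈Q C → endpoint X ≡ + 1
    endpoint-C {X} e rewrite dec-true (X ≟Q C) e = refl

    endpoint-C' : ∀ {X} → X ≈Q C' → endpoint X ≡ - + 1
    endpoint-C' {X} e
      rewrite dec-false (X ≟Q C) (λ f → proper (≈-trans {Y = X} (≈-sym {X = X} f) e)) | dec-true (X ≟Q C') e = refl

    endpoint-else : ∀ {X} → ¬ X ≈Q C → ¬ X ≈Q C' → endpoint X ≡ + 0
    endpoint-else {X} e f rewrite dec-false (X ≟Q C) e | dec-false (X ≟Q C') f = refl

    endpoint-cong : ∀ {X Y} → X ≈Q Y → endpoint X ≡ endpoint Y
    endpoint-cong {X} {Y} e with toSum (Y ≟Q C) | toSum (Y ≟Q C')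
    ... | inj₁ p | _      = trans (endpoint-C (≈-trans {Y = Y} e p)) (sym (endpoint-C p))
    ... | inj₂ _ | inj₁ q = trans (endpoint-C' (≈-trans {Y = Y} e q)) (sym (endpoint-C' q))
    ... | inj₂ p | inj₂ q = trans (endpoint-else (p ∘ ≈-trans {Y = X} (≈-sym {X = X} e)) (q ∘ ≈-trans {Y = X} (≈-sym {X = X} e)))
                                  (sym (endpoint-else p q))

    endpoint-μ : ∀ X → endpoint X + endpoint (μ ℓ X) ≡ + 0
    endpoint-μ X with toSum (X ≟Q C) | toSum (X ≟Q C')
    ... | inj₁ p | _      = cong₂ _+_ (endpoint-C p) (endpoint-C' (μ-cong ℓ p))
    ... | inj₂ _ | inj₁ q = cong₂ _+_ (endpoint-C' q) (endpoint-C (≈-trans {Y = μ ℓ C'} (μ-cong ℓ q) (μ-involutive ℓ C)))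
    ... | inj₂ p | inj₂ q = cong₂ _+_ (endpoint-else p q) (endpoint-else
            (λ f → q (≈-trans {Y = μ ℓ (μ ℓ X)} (≈-sym {X = μ ℓ (μ ℓ X)} (μ-involutive ℓ X)) (μ-cong ℓ f)))
            (λ f → p (≈-trans {Y = μ ℓ (μ ℓ X)} (≈-sym {X = μ ℓ (μ ℓ X)} (μ-involutive ℓ X))
                       (≈-trans {Y = μ ℓ C'} (μ-cong ℓ f) (μ-involutive ℓ C)))))

    passage-cong : ∀ {X Y} i → X ≈Q Y → passage X i ≡ passage Y i
    passage-cong i e = cong (λ z → if does (i Fin.≟ ℓ) then z else + 0) (endpoint-cong e)

    passage-ℓ : ∀ X → passage X ℓ ≡ endpoint X
    passage-ℓ X rewrite dec-true (ℓ Fin.≟ ℓ) refl = refl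

    passage-≢ : ∀ X {i} → i ≢ ℓ → passage X i ≡ + 0
    passage-≢ X {i} ne rewrite dec-false (i Fin.≟ ℓ) ne = refl

    passage-back : ∀ X i → passage X i + passage (μ i X) i ≡ + 0
    passage-back X i with i ≟⊎ ℓ
    ... | inj₁ refl = trans (cong₂ _+_ (passage-ℓ X) (passage-ℓ (μ ℓ X))) (endpoint-μ X)
    ... | inj₂ ne   = cong₂ _+_ (passage-≢ X ne) (passage-≢ (μ i X) ne)

    passages-cong : ∀ {X Y} w → X ≈Q Y → passages X w ≡ passages Y w
    passages-cong []      e = refl
    passages-cong (i ∷ w) e = cong₂ _+_ (passage-cong i e) (passages-cong w (μ-cong i e))

    passages-++ : ∀ X u v → passages X (u ++ v) ≡ passages X u + passages (mutSeq X u) v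
    passages-++ X []      v = sym (ℤP.+-identityˡ _)
    passages-++ X (i ∷ u) v = trans (cong (λ z → passage X i + z) (passages-++ (μ i X) u v)) (sym (ℤP.+-assoc (passage X i) _ _))

    passages-≢ : ∀ X {w} → All (_≢ ℓ) w → passages X w ≡ + 0
    passages-≢ X []         = refl
    passages-≢ X (ne ∷ nes) = cong₂ _+_ (passage-≢ X ne) (passages-≢ _ nes)

    passages-none : ∀ X w → (∀ u i v → w ≡ u ++ i ∷ v → passage (mutSeq X u) i ≡ + 0) → passages X w ≡ + 0
    passages-none X []      h = refl
    passages-none X (i ∷ w) h = cong₂ _+_ (h [] i w refl)
      (passages-none (μ i X) w (λ u j v e → h (i ∷ u) j v (cong (i ∷_) e)))

    module _ (L : ℕ) (long : ∀ w → Linked _≢_ (ℓ ∷ w ++ [ ℓ ]) → mutSeq C' w ≈Q C → L ℕ.≤ length w) where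

      -- Not only the signed sum but each single passage is zero: rebased at a passage through the
      -- edge, the cycle would leave a walk between its ends that lacks one letter of `c` and so is
      -- shorter than `L`.
      passages-cycle : ∀ X c → IsMutationCycle X c → length c ℕ.≤ L → passages X c ≡ + 0
      passages-cycle X c (distinct , _ , closed) short = passages-none X c none
        where
        none : ∀ u i v → c ≡ u ++ i ∷ v → passage (mutSeq X u) i ≡ + 0
        none u i v refl with i ≟⊎ ℓ
        ... | inj₂ ne   = passage-≢ _ ne
        ... | inj₁ refl = trans (passage-ℓ Y) (endpoint-else noC noC')
          where
          Y = mutSeq X u
          linked = rotate u ℓ v distinct
          around : mutSeq (μ ℓ Y) (v ++ u) ≈Q Y
          around = subst (_≈Q Y) (trans (cong (λ Z → mutSeq Z u) (mutSeq-++ X u (ℓ ∷ v))) (sym (mutSeq-++ (μ ℓ Y) v u)))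
                     (mutSeq-cong u closed)
          shorter : length (v ++ u) ℕ.< L
          shorter = subst (ℕ._≤ L) (trans (ListP.length-++ u) (trans (ℕP.+-suc (length u) (length v))
                      (cong suc (trans (ℕP.+-comm (length u) (length v)) (sym (ListP.length-++ v)))))) short
          noC : ¬ Y ≈Q C
          noC e = ℕP.<⇒≱ shorter (long (v ++ u) linked
            (≈-trans {Y = mutSeq (μ ℓ Y) (v ++ u)} (mutSeq-cong (v ++ u) (μ-cong ℓ (≈-sym {X = Y} e))) (≈-trans {Y = Y} around e)))
          noC' : ¬ Y ≈Q C'
          -- A passage from `C'` to `C` leaves a walk from `C` to `C'`; its reversal has the
          -- direction that `long` speaks of.
          noC' e = ℕP.<⇒≱ shorter (subst (L ℕ.≤_) (ListP.length-reverse (v ++ u)) (long (reverse (v ++ u)) linked' back))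
            where
            linked' : Linked _≢_ (ℓ ∷ reverse (v ++ u) ++ [ ℓ ])
            linked' = subst (Linked _≢_)
              (trans (ListP.unfold-reverse ℓ ((v ++ u) ++ [ ℓ ])) (cong (_++ [ ℓ ]) (ListP.reverse-++ (v ++ u) [ ℓ ])))
              (linked-reverse _ linked)
            fromC : mutSeq C (v ++ u) ≈Q C'
            fromC = ≈-trans {Y = mutSeq (μ ℓ Y) (v ++ u)}
              (mutSeq-cong (v ++ u) (≈-trans {Y = μ ℓ C'} (≈-sym {X = μ ℓ C'} (μ-involutive ℓ C)) (μ-cong ℓ (≈-sym {X = Y} e))))
              (≈-trans {Y = Y} around e)
            back : mutSeq C' (reverse (v ++ u)) ≈Q C
            back = mutSeq-back {X = C} (v ++ u) fromC

      passages-step : ∀ {P w w'} → PaveStep L P w w' → passages P w ≡ passages P w'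
      passages-step {P} (backtrack u v i) = begin
        passages P (u ++ v)                                       ≡⟨ passages-++ P u v ⟩
        passages P u + passages U v                               ≡⟨ cong (λ z → passages P u + z) inner ⟩
        passages P u + passages U (i ∷ i ∷ v)                     ≡⟨ passages-++ P u (i ∷ i ∷ v) ⟨
        passages P (u ++ i ∷ i ∷ v)                               ∎
        where
        open ≡-Reasoning
        U = mutSeq P u
        inner : passages U v ≡ passage U i + (passage (μ i U) i + passages (μ i (μ i U)) v)
        inner = begin
          passages U v                                                      ≡⟨ passages-cong v (≈-sym {X = μ i (μ i U)} (μ-involutive i U)) ⟩
          passages (μ i (μ i U)) v                                          ≡⟨ ℤP.+-identityˡ _ ⟨
          + 0 + passages (μ i (μ i U)) v                                    ≡⟨ cong (_+ passages (μ i (μ i U)) v) (passage-back U i) ⟨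
          (passage U i + passage (μ i U) i) + passages (μ i (μ i U)) v      ≡⟨ ℤP.+-assoc (passage U i) _ _ ⟩
          passage U i + (passage (μ i U) i + passages (μ i (μ i U)) v)      ∎
      passages-step {P} (cell u v c cyc short) = begin
        passages P (u ++ v)                                       ≡⟨ passages-++ P u v ⟩
        passages P u + passages U v                               ≡⟨ cong (λ z → passages P u + z) inner ⟩
        passages P u + passages U (c ++ v)                        ≡⟨ passages-++ P u (c ++ v) ⟨
        passages P (u ++ c ++ v)                                  ∎
        where
        open ≡-Reasoning
        U = mutSeq P u
        inner : passages U v ≡ passages U (c ++ v)
        inner = begin
          passages U v                            ≡⟨ passages-cong v (≈-sym {X = mutSeq U c} (proj₂ (proj₂ cyc))) ⟩
          passages (mutSeq U c) v                 ≡⟨ ℤP.+-identityˡ _ ⟨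
          + 0 + passages (mutSeq U c) v           ≡⟨ cong (_+ passages (mutSeq U c) v) (passages-cycle U c cyc short) ⟨
          passages U c + passages (mutSeq U c) v  ≡⟨ passages-++ U c v ⟨
          passages U (c ++ v)                     ∎

      passages-paved : ∀ {P w} → PavedBy L P w → passages P w ≡ + 0
      passages-paved done            = refl
      passages-paved (fwd s ◅ rest) = trans (passages-step s) (passages-paved rest)
      passages-paved (bwd s ◅ rest) = trans (sym (passages-step s)) (passages-paved rest)

  -- Sinks.

  module _ {n : ℕ} where

    -- The triangle avoids `z`, so `z` is no point of return. Any other point of return `r` lies on
    -- the triangle and has a predecessor `i` there; on the path from `i` through `r` to the sink,
    -- `heavy` would demand an arrow from the sink to `i`.
    sink-notFork : ∀ {X : Matrix n} z → (∀ {w} → w ≢ z → + 2 ≤ X w z) →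
      ∀ {a b c} → a ≢ z → b ≢ z → c ≢ z → + 2 ≤ X a b → + 2 ≤ X b c → + 2 ≤ X c a → NotFork X
    sink-notFork {X} z sink {a} {b} {c} a≢z b≢z c≢z ab bc ca r f with r ≟⊎ z
    ... | inj₁ refl = Fork.acyclic f a≢z b≢z c≢z ab bc ca
    ... | inj₂ r≢z = Fork.acyclic f (λ { refl → source c≢z ca }) (λ { refl → source a≢z ab }) (λ { refl → source b≢z bc }) ab bc ca
      where
      source : ∀ {i} → i ≢ z → + 2 ≤ X i r → ⊥
      source i≢z p = skew-antisym {X = X} (Fork.skew f) (sink i≢z) (ℤP.<⇒≤ (ℤP.≤-<-trans p (proj₁ (Fork.heavy f p (sink r≢z)))))

    μ-sink : ∀ {v} {X : Matrix n} → Skew X → (∀ w → X v w ≤ + 0) → ∀ {i j} → i ≢ v → j ≢ v → μ v X i j ≡ X i j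
    μ-sink {v} {X} sk sink {i} {j} i≢v j≢v =
      trans (μ-off X i≢v j≢v) (trans (cong (λ z → X i j + z)
        (half-≥≤ (subst (+ 0 ≤_) (sym (sk v i)) (ℤP.neg-mono-≤ (sink i))) (sink j))) (ℤP.+-identityʳ (X i j)))

  -- The orientations that occur on the two paths, and which exits lead to forks.

  lab : ∀ {m} → ℕ → Fin (2 ℕ.+ m)
  lab zero          = zero
  lab (suc zero)    = suc zero
  lab (suc (suc t)) = lab t

  data Labels {m} : Fin (2 ℕ.+ m) → Fin (2 ℕ.+ m) → Set where
    zo : Labels zero (suc zero)
    oz : Labels (suc zero) zero

  labels : ∀ {m} t → Labels {m} (lab t) (lab (suc t))
  labels zero          = zo
  labels (suc zero)    = oz
  labels (suc (suc t)) = labels t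

  Labels-swap : ∀ {m p s} → Labels {m} p s → Labels s p
  Labels-swap zo = oz
  Labels-swap oz = zo

  Labels-≢ : ∀ {m p s} → Labels {m} p s → s ≢ p
  Labels-≢ zo ()
  Labels-≢ oz ()

  -- P is the one of the vertices 1, 2 that is mutated next, S the other one, L the vertex n.
  data Kind (N : ℕ) : Set where
    P S L : Kind N
    M     : Fin N → Kind N

  module _ {N : ℕ} where

    mid : Fin N → Fin (3 ℕ.+ N)
    mid i = suc (suc (inject₁ i))

    top : Fin (3 ℕ.+ N)
    top = suc (suc (fromℕ N))

    mid-injective : ∀ {i j} → mid i ≡ mid j → i ≡ j
    mid-injective e = FinP.inject₁-injective (FinP.suc-injective (FinP.suc-injective e))

    top≢mid : ∀ {i} → top ≢ mid i
    top≢mid e = FinP.fromℕ≢inject₁ (FinP.suc-injective (FinP.suc-injective e))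

    mid≢label : ∀ {i p s} → Labels p s → mid i ≢ p
    mid≢label zo ()
    mid≢label oz ()

    top≢label : ∀ {p s} → Labels p s → top ≢ p
    top≢label zo ()
    top≢label oz ()

    vtx : Fin (3 ℕ.+ N) → Fin (3 ℕ.+ N) → Kind N → Fin (3 ℕ.+ N)
    vtx p s P     = p
    vtx p s S     = s
    vtx p s L     = top
    vtx p s (M i) = mid i

    kind : ∀ {p s} → Labels p s → ∀ v → ∃[ κ ] v ≡ vtx p s κ
    kind zo zero       = P , refl
    kind zo (suc zero) = S , refl
    kind oz zero       = S , refl
    kind oz (suc zero) = P , refl
    kind ls (suc (suc w)) with view w
    ... | ‵fromℕ     = L , refl
    ... | ‵inject₁ i = M i , refl

    -- The bits x, y, z orient the arrows between the top vertex and P, S and the M i.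
    data Arrow (x y z : Bool) : Kind N → Kind N → Set where
      PS : Arrow x y z P S
      SM : ∀ {i} → Arrow x y z S (M i)
      MP : ∀ {i} → Arrow x y z (M i) P
      MM : ∀ {i j} → i Fin.< j → Arrow x y z (M i) (M j)
      LP : x ≡ true  → Arrow x y z L P
      PL : x ≡ false → Arrow x y z P L
      LS : y ≡ true  → Arrow x y z L S
      SL : y ≡ false → Arrow x y z S L
      LM : ∀ {i} → z ≡ true  → Arrow x y z L (M i)
      ML : ∀ {i} → z ≡ false → Arrow x y z (M i) L

    clash : ∀ {b : Bool} → b ≡ true → b ≡ false → ⊥
    clash refl ()

    module _ {x y z : Bool} where

      private
        bit : ∀ b → b ≡ true ⊎ b ≡ false
        bit true  = inj₁ refl
        bit false = inj₂ refl

      arrow-total : ∀ κ κ' → κ ≡ κ' ⊎ (Arrow x y z κ κ' ⊎ Arrow x y z κ' κ)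
      arrow-total P P = inj₁ refl
      arrow-total P S = inj₂ (inj₁ PS)
      arrow-total P L = inj₂ (swap (map⊎ LP PL (bit x)))
      arrow-total P (M i) = inj₂ (inj₂ MP)
      arrow-total S P = inj₂ (inj₂ PS)
      arrow-total S S = inj₁ refl
      arrow-total S L = inj₂ (swap (map⊎ LS SL (bit y)))
      arrow-total S (M i) = inj₂ (inj₁ SM)
      arrow-total L P = inj₂ (map⊎ LP PL (bit x))
      arrow-total L S = inj₂ (map⊎ LS SL (bit y))
      arrow-total L L = inj₁ refl
      arrow-total L (M i) = inj₂ (map⊎ LM ML (bit z))
      arrow-total (M i) P = inj₂ (inj₁ MP)
      arrow-total (M i) S = inj₂ (inj₂ SM)
      arrow-total (M i) L = inj₂ (swap (map⊎ LM ML (bit z)))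
      arrow-total (M i) (M j) with FinP.<-cmp i j
      ... | tri< i<j _ _  = inj₂ (inj₁ (MM i<j))
      ... | tri≈ _ refl _ = inj₁ refl
      ... | tri> _ _ j<i  = inj₂ (inj₂ (MM j<i))

      -- All oriented triangles up to rotation. The mid vertices are linearly ordered and relate in
      -- the same way to each of the three other vertices, so a triangle contains at most one of
      -- them.
      data Cycle : Kind N → Kind N → Kind N → Set where
        psm : ∀ i → Cycle P S (M i)
        psl : x ≡ true → y ≡ false → Cycle P S L
        sml : ∀ i → y ≡ true → z ≡ false → Cycle S (M i) L
        plm : ∀ i → x ≡ false → z ≡ true → Cycle P L (M i)
        rot : ∀ {a b c} → Cycle a b c → Cycle b c a

      classify : ∀ {a b c} → Arrow x y z a b → Arrow x y z b c → Arrow x y z c a → Cycle a b c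
      classify PS     SM      MP     = psm _
      classify PS     (SL e)  (LP f) = psl f e
      classify SM     MP      PS     = rot (psm _)
      classify SM     (ML e)  (LS f) = sml _ f e
      classify (SL e) (LP f)  PS     = rot (psl f e)
      classify MP     PS      SM     = rot (rot (psm _))
      classify MP     (PL e)  (LM f) = rot (rot (plm _ e f))
      classify (MM p) (MM q)  (MM r) = ⊥-elim (FinP.<-irrefl refl (FinP.<-trans (FinP.<-trans p q) r))
      classify (MM _) (ML e)  (LM f) = ⊥-elim (clash f e)
      classify (ML e) (LS f)  SM     = rot (sml _ f e)
      classify (ML e) (LM f)  _      = ⊥-elim (clash f e)
      classify (LP e) PS      (SL f) = rot (rot (psl e f))
      classify (PL e) (LM f)  MP     = plm _ e f
      classify (LS e) SM      (ML f) = rot (rot (sml _ e f))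
      classify (LM e) MP      (PL f) = rot (plm _ f e)
      classify (LM e) (MM _)  (ML f) = ⊥-elim (clash e f)

      -- `W` stands for the predecessors, or the successors, of the vertex to be mutated.
      no-cycle : ∀ (W : Kind N → Set) → (∀ {i} → W P → W S → W (M i) → ⊥) →
        (x ≡ true → y ≡ false → W P → W S → W L → ⊥) →
        (∀ {i} → y ≡ true → z ≡ false → W S → W (M i) → W L → ⊥) →
        (∀ {i} → x ≡ false → z ≡ true → W P → W L → W (M i) → ⊥) →
        ∀ {a b c} → Cycle a b c → W a → W b → W c → ⊥
      no-cycle W f g h k (psm i)     = f
      no-cycle W f g h k (psl e e')   = g e e'
      no-cycle W f g h k (sml i e e') = h e e'
      no-cycle W f g h k (plm i e e') = k e e'
      no-cycle W f g h k (rot c) b c' a = no-cycle W f g h k c a b c'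

    record Oriented (x y z : Bool) (p s : Fin (3 ℕ.+ N)) (X : Matrix (3 ℕ.+ N)) : Set where
      field
        skew   : Skew X
        lbl    : Labels p s
        arrows : ∀ {κ κ'} → Arrow x y z κ κ' → + 2 ≤ X (vtx p s κ) (vtx p s κ')

      unarrow : ∀ κ κ' → + 2 ≤ X (vtx p s κ) (vtx p s κ') → Arrow x y z κ κ'
      unarrow κ κ' h with arrow-total κ κ'
      ... | inj₁ refl     = ⊥-elim (skew-antisym {X = X} skew h h)
      ... | inj₂ (inj₁ a) = a
      ... | inj₂ (inj₂ a) = ⊥-elim (skew-antisym {X = X} skew h (arrows a))

      abundant : Abundant X
      abundant {i} {j} i≢j with kind lbl i | kind lbl j
      ... | κ , refl | κ' , refl with arrow-total κ κ'
      ...   | inj₁ refl     = ⊥-elim (i≢j refl)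
      ...   | inj₂ (inj₁ a) = inj₁ (arrows a)
      ...   | inj₂ (inj₂ a) = inj₂ (arrows a)

      preFork : ∀ κ →
        (∀ {a b c} → Cycle {x} {y} {z} a b c → Arrow x y z a κ → Arrow x y z b κ → Arrow x y z c κ → ⊥) →
        (∀ {a b c} → Cycle {x} {y} {z} a b c → Arrow x y z κ a → Arrow x y z κ b → Arrow x y z κ c → ⊥) →
        (∀ {a b} → Arrow x y z a κ → Arrow x y z κ b → Arrow x y z b a →
          X (vtx p s b) (vtx p s a) < X (vtx p s a) (vtx p s κ) ⊎ X (vtx p s b) (vtx p s a) < X (vtx p s κ) (vtx p s b)) →
        PreFork (vtx p s κ) X
      preFork κ noIn noOut lgt = record
        { skew = skew ; abundant = abundant ; acyclicIn = aIn ; acyclicOut = aOut ; light = light }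
        where
        aIn : ∀ {a b c} → + 2 ≤ X a (vtx p s κ) → + 2 ≤ X b (vtx p s κ) → + 2 ≤ X c (vtx p s κ) →
              + 2 ≤ X a b → + 2 ≤ X b c → + 2 ≤ X c a → ⊥
        aIn {a} {b} {c} ha hb hc ab bc ca with kind lbl a | kind lbl b | kind lbl c
        ... | a' , refl | b' , refl | c' , refl =
          noIn (classify (unarrow a' b' ab) (unarrow b' c' bc) (unarrow c' a' ca))
               (unarrow a' κ ha) (unarrow b' κ hb) (unarrow c' κ hc)
        aOut : ∀ {a b c} → + 2 ≤ X (vtx p s κ) a → + 2 ≤ X (vtx p s κ) b → + 2 ≤ X (vtx p s κ) c →
              + 2 ≤ X a b → + 2 ≤ X b c → + 2 ≤ X c a → ⊥
        aOut {a} {b} {c} ha hb hc ab bc ca with kind lbl a | kind lbl b | kind lbl c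
        ... | a' , refl | b' , refl | c' , refl =
          noOut (classify (unarrow a' b' ab) (unarrow b' c' bc) (unarrow c' a' ca))
               (unarrow κ a' ha) (unarrow κ b' hb) (unarrow κ c' hc)
        light : ∀ {i j} → + 2 ≤ X i (vtx p s κ) → + 2 ≤ X (vtx p s κ) j → X j i < X i (vtx p s κ) ⊎ X j i < X (vtx p s κ) j
        light {i} {j} hi hj with kind lbl i | kind lbl j
        ... | i' , refl | j' , refl with arrow-total {x} {y} {z} i' j'
        ...   | inj₁ refl      = ⊥-elim (skew-antisym {X = X} skew hi hj)
        ...   | inj₂ (inj₁ ij) = inj₁ (≤-< (skew-≤0 {X = X} skew (arrows ij)) hi)
        ...   | inj₂ (inj₂ ji) = lgt (unarrow i' κ hi) (unarrow κ j' hj) ji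

      -- With the first hypothesis, only two kinds of triangles can pass through `M i`: the one with
      -- `P` and `S`, and the one with `S` and the top vertex. The inequalities say that its side
      -- opposite `M i` is lighter than a side at `M i`.
      preFork-M : ∀ i → (x ≡ false → z ≡ true → ⊥) → X p s < X s (mid i) →
        (y ≡ true → z ≡ false → X top s < X (mid i) top) → PreFork (mid i) X
      preFork-M i xz ps<sm ls<ml = preFork (M i)
        (no-cycle (λ a → Arrow x y z a (M i)) (λ ()) (λ _ _ ()) (λ { _ e _ _ (LM f) → clash f e }) (λ e f _ _ _ → xz e f))
        (no-cycle (λ a → Arrow x y z (M i) a) (λ _ ()) (λ _ _ _ ()) (λ _ _ ()) (λ e f _ _ _ → xz e f))
        lgt
        where
        lgt : ∀ {a b} → Arrow x y z a (M i) → Arrow x y z (M i) b → Arrow x y z b a →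
          X (vtx p s b) (vtx p s a) < X (vtx p s a) (mid i) ⊎ X (vtx p s b) (vtx p s a) < X (mid i) (vtx p s b)
        lgt SM     MP     PS     = inj₁ ps<sm
        lgt SM     (ML e) (LS f) = inj₂ (ls<ml f e)
        lgt (MM q) (MM r) (MM t) = ⊥-elim (FinP.<-irrefl refl (FinP.<-trans (FinP.<-trans q r) t))
        lgt (MM _) (ML e) (LM f) = ⊥-elim (clash f e)
        lgt (LM e) MP     (PL f) = ⊥-elim (xz f e)
        lgt (LM e) (MM _) (ML f) = ⊥-elim (clash e f)

      -- The second hypothesis says that the top vertex is neither a source nor a sink. Otherwise
      -- the triangle of `P`, `S` and `M i`, which is always oriented, would lie among its
      -- predecessors or its successors.
      preFork-L : (x ≡ false → z ≡ true → ⊥) → (x ≡ y → y ≡ z → ⊥) → (x ≡ true → y ≡ false → X p s < X top p) →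
        (∀ i → y ≡ true → z ≡ false → X s (mid i) < X (mid i) top) → PreFork top X
      preFork-L xz xyz ps<lp sm<ml = preFork L
        (no-cycle (λ a → Arrow x y z a L) (λ { (PL e) (SL f) (ML g) → xyz (trans e (sym f)) (trans f (sym g)) })
          (λ _ _ _ _ ()) (λ _ _ _ _ ()) (λ _ _ _ ()))
        (no-cycle (λ a → Arrow x y z L a) (λ { (LP e) (LS f) (LM g) → xyz (trans e (sym f)) (trans f (sym g)) })
          (λ _ _ _ _ ()) (λ _ _ _ _ ()) (λ _ _ _ ()))
        lgt
        where
        lgt : ∀ {a b} → Arrow x y z a L → Arrow x y z L b → Arrow x y z b a →
          X (vtx p s b) (vtx p s a) < X (vtx p s a) top ⊎ X (vtx p s b) (vtx p s a) < X top (vtx p s b)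
        lgt (PL e) (LM f) MP     = ⊥-elim (xz e f)
        lgt (SL e) (LP f) PS     = inj₂ (ps<lp f e)
        lgt (ML e) (LS f) SM     = inj₁ (sm<ml _ f e)
        lgt (ML e) (LM f) _      = ⊥-elim (clash f e)

      -- The first two hypotheses exclude oriented triangles containing both `S` and the top vertex.
      -- What remains are those with `P` and a mid vertex.
      preFork-S : (x ≡ true → y ≡ false → ⊥) → (y ≡ true → z ≡ false → ⊥) →
        (∀ i → X (mid i) p < X s (mid i)) → PreFork s X
      preFork-S xy yz mp<sm = preFork S
        (no-cycle (λ a → Arrow x y z a S) (λ _ ()) (λ _ _ _ ()) (λ _ _ ()) (λ _ _ _ _ ()))
        (no-cycle (λ a → Arrow x y z S a) (λ ()) (λ _ _ ()) (λ _ _ ()) (λ _ _ ()))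
        lgt
        where
        lgt : ∀ {a b} → Arrow x y z a S → Arrow x y z S b → Arrow x y z b a →
          X (vtx p s b) (vtx p s a) < X (vtx p s a) s ⊎ X (vtx p s b) (vtx p s a) < X s (vtx p s b)
        lgt PS     SM     MP     = inj₂ (mp<sm _)
        lgt PS     (SL e) (LP f) = ⊥-elim (xy f e)
        lgt (LS e) SM     (ML f) = ⊥-elim (yz e f)
        lgt (LS e) (SL f) _      = ⊥-elim (clash e f)

  -- The weights of a quiver, their change under mutation, and the resulting recurrence.

  module _ {N : ℕ} where

    -- Determines `X` completely. The directions are chosen so that positive weights at `p` and `s`
    -- mean oriented triangles from `p` to `s` to the third vertex and back to `p`, for the mid
    -- vertices and the top vertex alike; both then obey the same recurrence.
    record Pair (p s : Fin (3 ℕ.+ N)) (a : ℤ) (α β ρ : Fin N → ℤ) (R : Fin N → Fin N → ℤ) (αℓ βℓ : ℤ)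
                (X : Matrix (3 ℕ.+ N)) : Set where
      field
        lbl  : Labels p s
        skew : Skew X
        ps   : X p s ≡ a
        mp   : ∀ i → X (mid i) p ≡ α i
        sm   : ∀ i → X s (mid i) ≡ β i
        ml   : ∀ i → X (mid i) top ≡ ρ i
        mm   : ∀ i j → X (mid i) (mid j) ≡ R i j
        lp   : X top p ≡ αℓ
        sl   : X s top ≡ βℓ

      sp : X s p ≡ - a
      sp = trans (skew p s) (cong -_ ps)
      pm : ∀ i → X p (mid i) ≡ - α i
      pm i = trans (skew (mid i) p) (cong -_ (mp i))
      ms : ∀ i → X (mid i) s ≡ - β i
      ms i = trans (skew s (mid i)) (cong -_ (sm i))
      lm : ∀ i → X top (mid i) ≡ - ρ i
      lm i = trans (skew (mid i) top) (cong -_ (ml i))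
      pl : X p top ≡ - αℓ
      pl = trans (skew top p) (cong -_ lp)
      ls : X top s ≡ - βℓ
      ls = trans (skew s top) (cong -_ sl)

    open Pair

    pair-unique : ∀ {p s a α β ρ R αℓ βℓ X Y} → Pair p s a α β ρ R αℓ βℓ X → Pair p s a α β ρ R αℓ βℓ Y → X ≈Q Y
    pair-unique {p} {s} {X = X} {Y} A B v w with kind (lbl A) v | kind (lbl A) w
    ... | κ , refl | κ' , refl = go κ κ'
      where
      diag : ∀ v → X v v ≡ Y v v
      diag v = trans (i≡-i⇒i≡0 (skew A v v)) (sym (i≡-i⇒i≡0 (skew B v v)))
      go : ∀ κ κ' → X (vtx p s κ) (vtx p s κ') ≡ Y (vtx p s κ) (vtx p s κ')
      go P P = diag _
      go P S = trans (ps A) (sym (ps B))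
      go P L = trans (pl A) (sym (pl B))
      go P (M i) = trans (pm A i) (sym (pm B i))
      go S P = trans (sp A) (sym (sp B))
      go S S = diag _
      go S L = trans (sl A) (sym (sl B))
      go S (M i) = trans (sm A i) (sym (sm B i))
      go L P = trans (lp A) (sym (lp B))
      go L S = trans (ls A) (sym (ls B))
      go L L = diag _
      go L (M i) = trans (lm A i) (sym (lm B i))
      go (M i) P = trans (mp A i) (sym (mp B i))
      go (M i) S = trans (ms A i) (sym (ms B i))
      go (M i) L = trans (ml A i) (sym (ml B i))
      go (M i) (M j) = trans (mm A i j) (sym (mm B i j))

    pair-cong : ∀ {p s a α β ρ R αℓ βℓ α' β' ρ' R' αℓ' βℓ' X} → (∀ i → α i ≡ α' i) → (∀ i → β i ≡ β' i) → (∀ i → ρ i ≡ ρ' i) →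
      (∀ i j → R i j ≡ R' i j) → αℓ ≡ αℓ' → βℓ ≡ βℓ' →
      Pair p s a α β ρ R αℓ βℓ X → Pair p s a α' β' ρ' R' αℓ' βℓ' X
    pair-cong e f g h refl refl A = record
      { lbl = lbl A ; skew = skew A ; ps = ps A
      ; mp = λ i → trans (mp A i) (e i) ; sm = λ i → trans (sm A i) (f i) ; ml = λ i → trans (ml A i) (g i)
      ; mm = λ i j → trans (mm A i j) (h i j) ; lp = lp A ; sl = sl A }

    SameSign : (Fin N → ℤ) → Set
    SameSign α = (∀ i → + 0 ≤ α i) ⊎ (∀ i → α i ≤ + 0)

    same-sign-half : ∀ {α} → SameSign α → ∀ i j → half (α i) (- α j) ≡ + 0
    same-sign-half (inj₁ h) i j = half-≥≤ (h i) (ℤP.neg-mono-≤ (h j))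
    same-sign-half (inj₂ h) i j = half-≤≥ (h i) (ℤP.neg-mono-≤ (h j))

    -- Mutation at `p` exchanges the roles of the two labels. As all mid vertices lie on the same
    -- side of `p`, no path through `p` joins two of them, and `R` stays.
    pair-step : ∀ {p s a α β ρ R αℓ βℓ X} → SameSign α → Pair p s a α β ρ R αℓ βℓ X →
      Pair s p a (λ i → - β i + half (α i) a) α (λ i → ρ i + half (α i) (- αℓ)) R (- βℓ + half αℓ a) αℓ (μ p X)
    pair-step {p} {s} {X = X} same A = record
      { lbl = Labels-swap (lbl A)
      ; skew = μ-skew p {X} (skew A)
      ; ps = trans (μ-col p X s) (trans (sym (skew A s p)) (ps A))
      ; mp = λ i → trans (μ-off X (m≢p i) s≢p) (cong₂ _+_ (ms A i) (cong₂ half (mp A i) (ps A)))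
      ; sm = λ i → trans (μ-row p X (mid i)) (trans (sym (skew A p (mid i))) (mp A i))
      ; ml = λ i → trans (μ-off X (m≢p i) l≢p) (cong₂ _+_ (ml A i) (cong₂ half (mp A i) (pl A)))
      ; mm = λ i j → trans (μ-off X (m≢p i) (m≢p j)) (trans (cong₂ _+_ (mm A i j)
               (trans (cong₂ half (mp A i) (pm A j)) (same-sign-half same i j))) (ℤP.+-identityʳ _))
      ; lp = trans (μ-off X l≢p s≢p) (cong₂ _+_ (ls A) (cong₂ half (lp A) (ps A)))
      ; sl = trans (μ-row p X top) (trans (sym (skew A p top)) (lp A))
      }
      where
      m≢p : ∀ i → mid i ≢ p
      m≢p i = mid≢label (lbl A)
      l≢p : top ≢ p
      l≢p = top≢label (lbl A)
      s≢p : s ≢ p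
      s≢p = Labels-≢ (lbl A)

    -- The sign conditions make `mid k` a sink, so the mutation merely reverses its arrows. The new
    -- weights are arbitrary functions with the required values, so that a closed form can be
    -- supplied for them.
    pair-flip : ∀ {p s a α β ρ R αℓ βℓ X} k → Pair p s a α β ρ R αℓ βℓ X →
      α k ≤ + 0 → + 0 ≤ β k → ρ k ≤ + 0 → (∀ j → R k j ≤ + 0) →
      ∀ {α' β' ρ' R'} →
      (α' k ≡ - α k × β' k ≡ - β k × ρ' k ≡ - ρ k × (∀ j → R' k j ≡ - R k j) × (∀ j → R' j k ≡ - R j k)) →
      (∀ i → i ≢ k → α' i ≡ α i × β' i ≡ β i × ρ' i ≡ ρ i × (∀ j → j ≢ k → R' i j ≡ R i j)) →
      Pair p s a α' β' ρ' R' αℓ βℓ (μ (mid k) X)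
    pair-flip {p} {s} {X = X} k A α≤ β≥ ρ≤ R≤ {α'} {β'} {ρ'} {R'} (eα , eβ , eρ , eR , eR') off = record
      { lbl = lbl A
      ; skew = μ-skew (mid k) {X} (skew A)
      ; ps = trans (keep p≢ s≢) (ps A)
      ; mp = mp'
      ; sm = sm'
      ; ml = ml'
      ; mm = mm'
      ; lp = trans (keep top≢mid p≢) (lp A)
      ; sl = trans (keep s≢ top≢mid) (sl A)
      }
      where
      p≢ : p ≢ mid k
      p≢ = mid≢label (lbl A) ∘ sym
      s≢ : s ≢ mid k
      s≢ = mid≢label (Labels-swap (lbl A)) ∘ sym
      m≢ : ∀ {i} → i ≢ k → mid i ≢ mid k
      m≢ ne e = ne (mid-injective e)
      sink : ∀ w → X (mid k) w ≤ + 0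
      sink w with kind (lbl A) w
      ... | P , refl   = subst (_≤ + 0) (sym (mp A k)) α≤
      ... | S , refl   = subst (_≤ + 0) (sym (ms A k)) (ℤP.neg-mono-≤ β≥)
      ... | L , refl   = subst (_≤ + 0) (sym (ml A k)) ρ≤
      ... | M j , refl = subst (_≤ + 0) (sym (mm A k j)) (R≤ j)
      keep : ∀ {i j} → i ≢ mid k → j ≢ mid k → μ (mid k) X i j ≡ X i j
      keep = μ-sink {X = X} (skew A) sink
      mp' : ∀ i → μ (mid k) X (mid i) p ≡ α' i
      mp' i with i ≟⊎ k
      ... | inj₁ refl = trans (μ-row (mid k) X p) (trans (cong -_ (mp A k)) (sym eα))
      ... | inj₂ ne   = trans (keep (m≢ ne) p≢) (trans (mp A i) (sym (proj₁ (off i ne))))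
      sm' : ∀ i → μ (mid k) X s (mid i) ≡ β' i
      sm' i with i ≟⊎ k
      ... | inj₁ refl = trans (μ-col (mid k) X s) (trans (cong -_ (sm A k)) (sym eβ))
      ... | inj₂ ne   = trans (keep s≢ (m≢ ne)) (trans (sm A i) (sym (proj₁ (proj₂ (off i ne)))))
      ml' : ∀ i → μ (mid k) X (mid i) top ≡ ρ' i
      ml' i with i ≟⊎ k
      ... | inj₁ refl = trans (μ-row (mid k) X top) (trans (cong -_ (ml A k)) (sym eρ))
      ... | inj₂ ne   = trans (keep (m≢ ne) top≢mid) (trans (ml A i) (sym (proj₁ (proj₂ (proj₂ (off i ne))))))
      mm' : ∀ i j → μ (mid k) X (mid i) (mid j) ≡ R' i j
      mm' i j with i ≟⊎ k | j ≟⊎ k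
      ... | inj₁ refl | _         = trans (μ-row (mid k) X (mid j)) (trans (cong -_ (mm A k j)) (sym (eR j)))
      ... | inj₂ _    | inj₁ refl = trans (μ-col (mid k) X (mid i)) (trans (cong -_ (mm A i k)) (sym (eR' i)))
      ... | inj₂ ne   | inj₂ ne'  = trans (keep (m≢ ne) (m≢ ne')) (trans (mm A i j) (sym (proj₂ (proj₂ (proj₂ (off i ne))) j ne')))

  -- The weights at a third vertex under alternating mutations at two vertices joined by a arrows;
  -- the first one is negated so that the recurrence covers the step at which the signs change.
  wind : ℤ → ℤ → ℤ → ℕ → ℤ
  wind a x y zero          = - x
  wind a x y (suc zero)    = y
  wind a x y (suc (suc i)) = a * wind a x y (suc i) - wind a x y i

  wind-back : ∀ a x y i → wind a x y i ≡ - wind a x y (suc (suc i)) + wind a x y (suc i) * a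
  wind-back a x y i = e a (wind a x y (suc i)) (wind a x y i)
    where
    e : ∀ a w u → u ≡ - (a * w - u) + w * a
    e = solve-∀

  wind-forth : ∀ a x y i → wind a x y (suc (suc i)) ≡ - wind a x y i + wind a x y (suc i) * a
  wind-forth a x y i = e a (wind a x y (suc i)) (wind a x y i)
    where
    e : ∀ a w u → a * w - u ≡ - u + w * a
    e = solve-∀

  -- The `pseq a j` are the Chebyshev values U_j(a/2); they are the coefficients with which the
  -- solution of the recurrence depends on its initial values.
  wind-pseq : ∀ a x y i → wind a x y (suc (suc i)) ≡ pseq a i * x + pseq a (suc i) * y
  wind-pseq a x y zero = e a x y
    where
    e : ∀ a x y → a * y - (- x) ≡ + 1 * x + a * y
    e = solve-∀
  wind-pseq a x y (suc zero) = e a x y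
    where
    e : ∀ a x y → a * (a * y - (- x)) - y ≡ a * x + (a * a - + 1) * y
    e = solve-∀
  wind-pseq a x y (suc (suc i)) =
    trans (cong₂ (λ u w → a * u - w) (wind-pseq a x y (suc i)) (wind-pseq a x y i))
          (e a x y (pseq a i) (pseq a (suc i)) (pseq a (suc (suc i))))
    where
    e : ∀ a x y p q r → a * (q * x + r * y) - (p * x + q * y) ≡ (a * q - p) * x + (a * r - q) * y
    e = solve-∀

  -- The arrows between a mid vertex and top that the first mutations of the path C (below) create
  -- are those that its last mutations cancel.
  wind-balance : ∀ a x y u v i →
    wind a x y (suc i) * u + wind a x y i * v ≡ x * wind a v u i + y * wind a v u (suc i)
  wind-balance a x y u v zero = e x y u v
    where
    e : ∀ x y u v → y * u + - x * v ≡ x * - v + y * u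
    e = solve-∀
  wind-balance a x y u v (suc zero) = e a x y u v
    where
    e : ∀ a x y u v → (a * y - - x) * u + y * v ≡ x * u + y * (a * u - - v)
    e = solve-∀
  wind-balance a x y u v (suc (suc i)) = begin
    (a * g₂ - g₁) * u + (a * g₁ - g₀) * v                   ≡⟨ e₁ a u v g₀ g₁ g₂ ⟩
    a * (g₂ * u + g₁ * v) - (g₁ * u + g₀ * v)               ≡⟨ cong₂ (λ s t → a * s - t) (wind-balance a x y u v (suc i)) (wind-balance a x y u v i) ⟩
    a * (x * h₁ + y * h₂) - (x * h₀ + y * h₁)               ≡⟨ e₂ a x y h₀ h₁ h₂ ⟩
    x * (a * h₁ - h₀) + y * (a * h₂ - h₁)                   ∎
    where
    open ≡-Reasoning
    g₀ g₁ g₂ h₀ h₁ h₂ : ℤ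
    g₀ = wind a x y i
    g₁ = wind a x y (suc i)
    g₂ = wind a x y (suc (suc i))
    h₀ = wind a v u i
    h₁ = wind a v u (suc i)
    h₂ = wind a v u (suc (suc i))
    e₁ : ∀ a u v g₀ g₁ g₂ → (a * g₂ - g₁) * u + (a * g₁ - g₀) * v ≡ a * (g₂ * u + g₁ * v) - (g₁ * u + g₀ * v)
    e₁ = solve-∀
    e₂ : ∀ a x y h₀ h₁ h₂ → a * (x * h₁ + y * h₂) - (x * h₀ + y * h₁) ≡ x * (a * h₁ - h₀) + y * (a * h₂ - h₁)
    e₂ = solve-∀

  module _ {a x y : ℤ} (2≤a : + 2 ≤ a) (2≤x : + 2 ≤ x) (2≤y : + 2 ≤ y) where

    private
      W : ℕ → ℤ
      W = wind a x y

    -- As `a` is at least 2, the next term is at least `2 w - u`, which exceeds `w` once `w` exceeds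
    -- `u`. The negated initial weight `- x` starts the induction.
    wind-grows : ∀ i → + 2 ≤ W (suc i) × W i < W (suc i)
    wind-grows zero    = 2≤y , ≤-< (2≤⇒-≤0 2≤x) 2≤y
    wind-grows (suc i) with wind-grows i
    ... | 2≤w , u<w = ℤP.<⇒≤ (ℤP.≤-<-trans 2≤w w<next) , w<next
      where
      open ℤP.≤-Reasoning
      e : ∀ w → w ≡ + 2 * w - w
      e = solve-∀
      w<next : W (suc i) < a * W (suc i) - W i
      w<next = begin-strict
        W (suc i)                     ≡⟨ e (W (suc i)) ⟩
        + 2 * W (suc i) - W (suc i)   ≤⟨ ℤP.+-monoˡ-≤ (- W (suc i)) (ℤP.*-monoʳ-≤-nonNeg (W (suc i)) {{ℤ.nonNegative (2≤⇒0≤ 2≤w)}} 2≤a) ⟩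
        a * W (suc i) - W (suc i)     <⟨ ℤP.+-monoʳ-< (a * W (suc i)) (ℤP.neg-mono-< u<w) ⟩
        a * W (suc i) - W i           ∎

    2≤wind : ∀ i → + 2 ≤ W (suc i)
    2≤wind i = proj₁ (wind-grows i)

    wind-< : ∀ {i j} → i ℕ.<′ j → W i < W j
    wind-< {i}         ℕ.<′-base     = proj₂ (wind-grows i)
    wind-< {j = suc j} (ℕ.<′-step p) = ℤP.<-trans (wind-< p) (proj₂ (wind-grows j))

    -- Already `a y + x` exceeds `a`. This makes the arrow between 1 and 2 the light side of the
    -- triangles in `preFork-M` and `preFork-L`.
    a<wind : ∀ i → a < W (suc (suc i))
    a<wind zero    = begin-strict
      a             ≡⟨ ℤP.*-identityʳ a ⟨
      a * + 1       ≤⟨ ℤP.*-monoˡ-≤-nonNeg a {{ℤ.nonNegative (2≤⇒0≤ 2≤a)}} (ℤP.≤-trans (+≤+ (ℕ.s≤s ℕ.z≤n)) 2≤y) ⟩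
      a * y         ≡⟨ ℤP.+-identityʳ (a * y) ⟨
      a * y + + 0   <⟨ ℤP.+-monoʳ-< (a * y) (ℤP.<-≤-trans (+<+ (ℕ.s≤s ℕ.z≤n)) (subst (+ 2 ≤_) (sym (ℤP.neg-involutive x)) 2≤x)) ⟩
      a * y - - x   ∎
      where open ℤP.≤-Reasoning
    a<wind (suc i) = ℤP.<-trans (a<wind i) (proj₂ (wind-grows (suc (suc i))))

  -- The word of the cycle and the quivers it visits.

  module _ {n : ℕ} where

    -- The final quiver is left out: on a closed walk it is the initial one again, and in a
    -- concatenation it belongs to the next word.
    visited : Matrix n → List (Fin n) → List (Matrix n)
    visited X []      = []
    visited X (i ∷ w) = X ∷ visited (μ i X) w

    visited-++ : ∀ X u v → visited X (u ++ v) ≡ visited X u ++ visited (mutSeq X u) v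
    visited-++ X []      v = refl
    visited-++ X (i ∷ u) v = cong (X ∷_) (visited-++ (μ i X) u v)

    All-visited : ∀ {P : Matrix n → Set} {X} w → All P (visited X w) → ∀ (b : Fin (length w)) → P (mutSeq X (take (toℕ b) w))
    All-visited (i ∷ w) (p ∷ ps) zero    = p
    All-visited (i ∷ w) (p ∷ ps) (suc b) = All-visited w ps b

    _≉_ : Matrix n → Matrix n → Set
    X ≉ Y = ¬ X ≈Q Y

    visited-distinct : ∀ {X} w → AllPairs _≉_ (visited X w) → ∀ (b c : Fin (length w)) → b ≢ c →
      ¬ mutSeq X (take (toℕ b) w) ≈Q mutSeq X (take (toℕ c) w)
    visited-distinct (i ∷ w) ps       zero    zero    ne   = ⊥-elim (ne refl)
    visited-distinct (i ∷ w) (p ∷ ps) zero    (suc c) ne   = All-visited w p c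
    visited-distinct {X} (i ∷ w) (p ∷ ps) (suc b) zero    ne   = λ e → All-visited w p b (≈-sym {X = mutSeq (μ i X) (take (toℕ b) w)} e)
    visited-distinct (i ∷ w) (p ∷ ps) (suc b) (suc c) ne   = visited-distinct w ps b c (ne ∘ cong suc)

    noIsolated-++ : ∀ {X : Matrix n} u {v} → NoIsolatedMutation X u → NoIsolatedMutation (mutSeq X u) v → NoIsolatedMutation X (u ++ v)
    noIsolated-++ []      _       q = q
    noIsolated-++ (i ∷ u) (p , r) q = p , noIsolated-++ u r q

    connected : ∀ (X : Matrix n) i j → + 2 ≤ X i j ⊎ + 2 ≤ X j i → ¬ Isolated X i
    connected X i j (inj₁ p) iso with subst (+ 2 ≤_) (proj₁ (iso j)) p
    ... | ℤ.+≤+ ()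
    connected X i j (inj₂ p) iso with subst (+ 2 ≤_) (proj₂ (iso j)) p
    ... | ℤ.+≤+ ()

  module _ {N : ℕ} where

    alternate : ℕ → ℕ → List (Fin (3 ℕ.+ N))
    alternate t zero    = []
    alternate t (suc r) = lab t ∷ alternate (suc t) r

    unwind : ℕ → List (Fin (3 ℕ.+ N))
    unwind zero    = []
    unwind (suc r) = lab r ∷ unwind r

    descend : ∀ c → (Fin c → Fin N) → List (Fin (3 ℕ.+ N))
    descend zero    g = []
    descend (suc c) g = mid (g (fromℕ c)) ∷ descend c (g ∘ inject₁)

    lab-double : ∀ k → lab {suc N} (2 ℕ.* k) ≡ zero
    lab-double zero = refl
    lab-double (suc k) rewrite ℕP.+-suc k (k ℕ.+ 0) = lab-double k

    alternate-concat : ∀ k → concat (replicate k (zero ∷ suc zero ∷ [])) ≡ alternate 0 (2 ℕ.* k)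
    alternate-concat zero = refl
    alternate-concat (suc k) rewrite ℕP.+-suc k (k ℕ.+ 0) =
      cong (λ w → zero ∷ suc zero ∷ w) (trans (alternate-concat k) (sym (shift 0 (2 ℕ.* k))))
      where
      shift : ∀ t r → alternate (2 ℕ.+ t) r ≡ alternate t r
      shift t zero    = refl
      shift t (suc r) = cong (lab t ∷_) (shift (suc t) r)

    lab-suc-double : ∀ k → lab {suc N} (suc (2 ℕ.* k)) ≡ suc zero
    lab-suc-double zero = refl
    lab-suc-double (suc k) rewrite ℕP.+-suc k (k ℕ.+ 0) = lab-suc-double k

    unwind-concat : ∀ k → concat (replicate k (suc zero ∷ zero ∷ [])) ≡ unwind (2 ℕ.* k)
    unwind-concat zero = refl
    unwind-concat (suc k) rewrite ℕP.+-suc k (k ℕ.+ 0) | lab-double k | lab-suc-double k =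
      cong (λ w → suc zero ∷ zero ∷ w) (unwind-concat k)

    tabulate-snoc : ∀ {A : Set} c (f : Fin (suc c) → A) → tabulate f ≡ tabulate (f ∘ inject₁) ++ [ f (fromℕ c) ]
    tabulate-snoc zero    f = refl
    tabulate-snoc (suc c) f = cong (f zero ∷_) (tabulate-snoc c (f ∘ suc))

    descend-reverse : ∀ c (g : Fin c → Fin N) → reverse (tabulate (mid ∘ g)) ≡ descend c g
    descend-reverse zero    g = refl
    descend-reverse (suc c) g = trans (cong reverse (tabulate-snoc c (mid ∘ g)))
      (trans (ListP.reverse-++ (tabulate (mid ∘ g ∘ inject₁)) [ mid (g (fromℕ c)) ])
             (cong (mid (g (fromℕ c)) ∷_) (descend-reverse c (g ∘ inject₁))))

    descent : reverse (map inject₁ (allFin (2 ℕ.+ N))) ≡ descend N id ++ suc zero ∷ zero ∷ []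
    descent = begin
      reverse (map inject₁ (allFin (2 ℕ.+ N)))                  ≡⟨ cong (λ w → reverse (zero ∷ suc zero ∷ w)) (ListP.map-tabulate (λ i → suc (suc i)) inject₁) ⟩
      reverse (zero ∷ suc zero ∷ tabulate mid)                  ≡⟨ ListP.reverse-++ (zero ∷ suc zero ∷ []) (tabulate mid) ⟩
      reverse (tabulate mid) ++ suc zero ∷ zero ∷ []            ≡⟨ cong (_++ suc zero ∷ zero ∷ []) (descend-reverse N id) ⟩
      descend N id ++ suc zero ∷ zero ∷ []                      ∎
      where open ≡-Reasoning

    -- The letters 2, 1 that end the descent are joined to the `k` pairs after it, since together
    -- they retrace one path of `2 + 2 * k` mutations from the given quiver.
    walk : ℕ → List (Fin (3 ℕ.+ N))
    walk k = top ∷ alternate 0 (2 ℕ.* k) ++ descend N id ++ unwind (2 ℕ.+ 2 ℕ.* k)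

    theCycle≡walk : ∀ k → theCycle {suc N} k ≡ walk k
    theCycle≡walk k = cong (top ∷_) (cong₂ _++_ (alternate-concat k) (begin
      reverse (map inject₁ (allFin (2 ℕ.+ N))) ++ concat (replicate k (suc zero ∷ zero ∷ []))   ≡⟨ cong₂ _++_ descent (unwind-concat k) ⟩
      (descend N id ++ suc zero ∷ zero ∷ []) ++ unwind (2 ℕ.* k)                                ≡⟨ ListP.++-assoc (descend N id) _ _ ⟩
      descend N id ++ suc zero ∷ zero ∷ unwind (2 ℕ.* k)                                        ≡⟨ cong (λ w → descend N id ++ w) pair ⟩
      descend N id ++ unwind (2 ℕ.+ 2 ℕ.* k)                                                    ∎))
      where
      open ≡-Reasoning
      pair : suc zero ∷ zero ∷ unwind (2 ℕ.* k) ≡ unwind (2 ℕ.+ 2 ℕ.* k)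
      pair = cong₂ (λ i j → i ∷ j ∷ unwind (2 ℕ.* k)) (sym (lab-suc-double k)) (sym (lab-double k))

    length-alternate : ∀ t r → length (alternate t r) ≡ r
    length-alternate t zero    = refl
    length-alternate t (suc r) = cong suc (length-alternate (suc t) r)

    length-unwind : ∀ r → length (unwind r) ≡ r
    length-unwind zero    = refl
    length-unwind (suc r) = cong suc (length-unwind r)

    length-descend : ∀ c g → length (descend c g) ≡ c
    length-descend zero    g = refl
    length-descend (suc c) g = cong suc (length-descend c (g ∘ inject₁))

    length-walk : ∀ k → length (walk k) ≡ (3 ℕ.+ N) ℕ.+ 4 ℕ.* k
    length-walk k = begin
      suc (length (alternate 0 (2 ℕ.* k) ++ descend N id ++ unwind (2 ℕ.+ 2 ℕ.* k)))
        ≡⟨ cong suc (trans (ListP.length-++ (alternate 0 (2 ℕ.* k))) (cong₂ ℕ._+_ (length-alternate 0 (2 ℕ.* k))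
             (trans (ListP.length-++ (descend N id)) (cong₂ ℕ._+_ (length-descend N id) (length-unwind (2 ℕ.+ 2 ℕ.* k)))))) ⟩
      suc (2 ℕ.* k ℕ.+ (N ℕ.+ (2 ℕ.+ 2 ℕ.* k)))
        ≡⟨ e N k ⟩
      (3 ℕ.+ N) ℕ.+ 4 ℕ.* k ∎
      where
      open ≡-Reasoning
      e : ∀ N k → suc (2 ℕ.* k ℕ.+ (N ℕ.+ (2 ℕ.+ 2 ℕ.* k))) ≡ (3 ℕ.+ N) ℕ.+ 4 ℕ.* k
      e = ℕSolver.solve-∀

    linked-alternate : ∀ {ys} → (∀ s → Linked _≢_ (lab s ∷ ys)) → ∀ t r → Linked _≢_ (lab t ∷ alternate (suc t) r ++ ys)
    linked-alternate h t zero    = h t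
    linked-alternate h t (suc r) = Labels-≢ (labels t) ∘ sym ∷ linked-alternate h (suc t) r

    linked-descend : ∀ {ys} → (∀ i → Linked _≢_ (mid i ∷ ys)) → ∀ c (g : Fin c → Fin N) → (∀ {i j} → g i ≡ g j → i ≡ j) →
      ∀ j → (∀ i → j ≢ g i) → Linked _≢_ (mid j ∷ descend c g ++ ys)
    linked-descend h zero    g inj j ne = h j
    linked-descend h (suc c) g inj j ne = ne (fromℕ c) ∘ mid-injective ∷
      linked-descend h c (g ∘ inject₁) (FinP.inject₁-injective ∘ inj) (g (fromℕ c)) (λ i e → FinP.fromℕ≢inject₁ (inj e))

    linked-unwind : ∀ r → Linked _≢_ (lab r ∷ unwind r ++ [ top ])
    linked-unwind zero    = (λ ()) ∷ [-]
    linked-unwind (suc r) = Labels-≢ (labels r) ∷ linked-unwind r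

  walk-distinct : ∀ {N'} k → CyclicallyDistinct (walk {suc N'} (suc k))
  walk-distinct {N'} k rewrite ℕP.+-suc k (k ℕ.+ 0) =
    subst (λ w → Linked _≢_ (top ∷ lab 0 ∷ w)) assoc ((λ ()) ∷ linked-alternate from-lab 0 (suc (2 ℕ.* k)))
    where
    N = suc N'
    D = descend {N} N id
    U = unwind {N} (4 ℕ.+ 2 ℕ.* k)
    assoc : alternate 1 (suc (2 ℕ.* k)) ++ D ++ (U ++ [ top ]) ≡ (alternate 1 (suc (2 ℕ.* k)) ++ D ++ U) ++ [ top ]
    assoc = trans (cong (λ w → alternate 1 (suc (2 ℕ.* k)) ++ w) (sym (ListP.++-assoc D U [ top ])))
                  (sym (ListP.++-assoc (alternate 1 (suc (2 ℕ.* k))) (D ++ U) [ top ]))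
    from-mid : ∀ (i : Fin N) → Linked _≢_ (mid i ∷ U ++ [ top ])
    from-mid i = mid≢label (labels (3 ℕ.+ 2 ℕ.* k)) ∷ linked-unwind (3 ℕ.+ 2 ℕ.* k)
    from-lab : ∀ s → Linked _≢_ (lab s ∷ D ++ U ++ [ top ])
    from-lab s = mid≢label (labels s) ∘ sym ∷
      linked-descend from-mid N' inject₁ FinP.inject₁-injective (fromℕ N') (λ i → FinP.fromℕ≢inject₁)

  signed : Bool → ℤ → ℤ
  signed true  w = w
  signed false w = - w

  2≤-- : ∀ {w} → + 2 ≤ w → + 2 ≤ - - w
  2≤-- {w} = subst (+ 2 ≤_) (sym (ℤP.neg-involutive w))

  orient : ∀ {N p s a α β ρ R αℓ βℓ} {X : Matrix (3 ℕ.+ N)} x y z → Pair p s a α β ρ R αℓ βℓ X →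
    + 2 ≤ a → (∀ i → + 2 ≤ α i) → (∀ i → + 2 ≤ β i) → (∀ {i j} → i Fin.< j → + 2 ≤ R i j) →
    + 2 ≤ signed x αℓ → + 2 ≤ - signed y βℓ → (∀ i → + 2 ≤ - signed z (ρ i)) → Oriented x y z p s X
  orient {X = X} x y z A 2≤a 2≤α 2≤β 2≤R 2≤αℓ 2≤βℓ 2≤ρ = record { skew = skew ; lbl = lbl ; arrows = arrows }
    where
    open Pair A
    2≤-resp : ∀ {w w'} → w ≡ w' → + 2 ≤ w' → + 2 ≤ w
    2≤-resp e = subst (+ 2 ≤_) (sym e)
    arrows : ∀ {κ κ'} → Arrow x y z κ κ' → + 2 ≤ X (vtx _ _ κ) (vtx _ _ κ')
    arrows PS        = 2≤-resp ps 2≤a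
    arrows SM        = 2≤-resp (sm _) (2≤β _)
    arrows MP        = 2≤-resp (mp _) (2≤α _)
    arrows (MM i<j)  = 2≤-resp (mm _ _) (2≤R i<j)
    arrows (LP refl) = 2≤-resp lp 2≤αℓ
    arrows (PL refl) = 2≤-resp pl 2≤αℓ
    arrows (LS refl) = 2≤-resp ls 2≤βℓ
    arrows (SL refl) = 2≤-resp (trans sl (sym (ℤP.neg-involutive _))) 2≤βℓ
    arrows (LM refl) = 2≤-resp (lm _) (2≤ρ _)
    arrows (ML refl) = 2≤-resp (trans (ml _) (sym (ℤP.neg-involutive _))) (2≤ρ _)

  module _ {n : ℕ} where

    -- The predicate `V` summarises the visited quivers, so that quivers on different parts of the
    -- walk can be told apart without referring to the words.
    record Tour (X : Matrix n) (w : List (Fin n)) (V : Matrix n → Set) : Set where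
      constructor tour
      field
        nonIsolated : NoIsolatedMutation X w
        visits      : All V (visited X w)
        distinct    : AllPairs _≉_ (visited X w)

    tour-++ : ∀ {X u v V W} → (∀ {Y Z} → V Y → W Z → Y ≉ Z) → Tour X u V → Tour (mutSeq X u) v W →
      Tour X (u ++ v) (λ Y → V Y ⊎ W Y)
    tour-++ {X} {u} {v} {V} {W} apart (tour ni vs ds) (tour ni' vs' ds') = tour (noIsolated-++ u ni ni')
      (subst (All (λ Y → V Y ⊎ W Y)) (sym (visited-++ X u v)) (AllP.++⁺ (All.map inj₁ vs) (All.map inj₂ vs')))
      (subst (AllPairs _≉_) (sym (visited-++ X u v)) (AllPairsP.++⁺ ds ds' (All.map (λ p → All.map (apart p) vs') vs)))

  module _ {m : ℕ} where

    -- Opaque, since conversion checking would otherwise unfold the matrices entry by entry.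
    opaque

      path : Matrix (2 ℕ.+ m) → ℕ → Matrix (2 ℕ.+ m)
      path X zero    = X
      path X (suc t) = μ (lab t) (path X t)

      path-zero : ∀ {X} → path X 0 ≡ X
      path-zero = refl

      path-suc : ∀ {X} t → path X (suc t) ≡ μ (lab t) (path X t)
      path-suc t = refl

  -- The two paths from the ends of the edge labelled n.

  module Winding {N' : ℕ} {a u v : ℤ} {x y ρ : Fin (suc N') → ℤ} {R : Fin (suc N') → Fin (suc N') → ℤ}
    (2≤a : + 2 ≤ a) (2≤u : + 2 ≤ u) (2≤v : + 2 ≤ v)
    (2≤x : ∀ i → + 2 ≤ x i) (2≤y : ∀ i → + 2 ≤ y i) (2≤ρ : ∀ i → + 2 ≤ ρ i)
    (2≤R : ∀ {i j} → i Fin.< j → + 2 ≤ R i j)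
    (K₂ : ℕ) (Q : Matrix (4 ℕ.+ N'))
    (Q-pair : Pair zero (suc zero) a (λ i → wind a (x i) (y i) (2 ℕ.+ K₂)) (λ i → wind a (x i) (y i) (3 ℕ.+ K₂))
                ρ R (- u) v Q)
    where

    N : ℕ
    N = suc N'

    -- This is 2k. It is given as `2 + K₂` because the first two steps of the path `C` differ from
    -- the later ones.
    K : ℕ
    K = 2 ℕ.+ K₂

    G : ℕ → Fin N → ℤ
    G r i = wind a (x i) (y i) r

    H : ℕ → ℤ
    H = wind a v u

    2≤G : ∀ r i → + 2 ≤ G (suc r) i
    2≤G r i = 2≤wind 2≤a (2≤x i) (2≤y i) r

    2≤H : ∀ t → + 2 ≤ H (suc t)
    2≤H = 2≤wind 2≤a 2≤v 2≤u

    0≤a : + 0 ≤ a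
    0≤a = 2≤⇒0≤ 2≤a

    G-step : ∀ r i → - G (suc (suc r)) i + half (G (suc r) i) a ≡ G r i
    G-step r i = trans (cong (λ z → - G (suc (suc r)) i + z) (half-≥≥ (2≤⇒0≤ (2≤G r i)) 0≤a)) (sym (wind-back a (x i) (y i) r))

    H-step : ∀ t → - H t + half (H (suc t)) a ≡ H (suc (suc t))
    H-step t = trans (cong (λ z → - H t + z) (half-≥≥ (2≤⇒0≤ (2≤H t)) 0≤a)) (sym (wind-forth a v u t))

    -- Shared by `A` and, from its quiver `C 2` on, by `C`. Both the mid vertices and the top vertex
    -- have arrows towards the label mutated next, so no arrows between them arise and `σ` stays.
    spin : ∀ {T σ} {D : ℕ → Matrix (4 ℕ.+ N')} → (∀ t → D (suc t) ≡ μ (lab t) (D t)) →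
      Pair zero (suc zero) a (G T) (G (suc T)) σ R (H 1) (H 0) (D 0) →
      ∀ t r → t ℕ.+ r ≡ T → Pair (lab t) (lab (suc t)) a (G r) (G (suc r)) σ R (H (suc t)) (H t) (D t)
    spin next D₀ zero    r refl = D₀
    spin {σ = σ} {D = D} next D₀ (suc t) r e = subst (Pair (lab (suc t)) (lab t) a (G r) (G (suc r)) σ R (H (2 ℕ.+ t)) (H (suc t))) (sym (next t))
      (pair-cong (G-step r) (λ _ → refl)
        (λ i → trans (cong (λ z → σ i + z) (half-≥≤ (2≤⇒0≤ (2≤G r i)) (2≤⇒-≤0 (2≤H t)))) (ℤP.+-identityʳ _))
        (λ _ _ → refl) (H-step t) refl
        (pair-step (inj₁ (λ i → 2≤⇒0≤ (2≤G r i))) (spin next D₀ t (suc r) (trans (ℕP.+-suc t r) e))))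

    -- The two paths of mutations at 1, 2, 1, 2, … from the ends of the edge labelled n at Q.
    A C : ℕ → Matrix (4 ℕ.+ N')
    A = path (μ top Q)
    C = path Q

    A₀-pair : Pair zero (suc zero) a (G K) (G (suc K)) (λ i → - ρ i) R u (- v) (A 0)
    A₀-pair = subst (Pair zero (suc zero) a (G K) (G (suc K)) (λ i → - ρ i) R u (- v)) (sym path-zero) record
      { lbl = zo ; skew = μ-skew top {Q} skew
      ; ps = trans (keep (λ ()) (λ ())) ps
      ; mp = λ i → trans (keep mid≢top (λ ())) (mp i)
      ; sm = λ i → trans (keep (λ ()) mid≢top) (sm i)
      ; ml = λ i → trans (μ-col top Q (mid i)) (cong -_ (ml i))
      ; mm = λ i j → trans (keep mid≢top mid≢top) (mm i j)
      ; lp = trans (μ-row top Q zero) (trans (cong -_ lp) (ℤP.neg-involutive u))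
      ; sl = trans (μ-col top Q (suc zero)) (cong -_ sl) }
      where
      open Pair Q-pair
      mid≢top : ∀ {i : Fin N} → mid i ≢ top
      mid≢top e = top≢mid (sym e)
      sink : ∀ w → Q top w ≤ + 0
      sink w with kind zo w
      ... | P , refl   = subst (_≤ + 0) (sym lp) (2≤⇒-≤0 2≤u)
      ... | S , refl   = subst (_≤ + 0) (sym ls) (2≤⇒-≤0 2≤v)
      ... | L , refl   = ℤP.≤-reflexive (i≡-i⇒i≡0 (skew top top))
      ... | M i , refl = subst (_≤ + 0) (sym (lm i)) (2≤⇒-≤0 (2≤ρ i))
      keep : ∀ {i j} → i ≢ top → j ≢ top → μ top Q i j ≡ Q i j
      keep = μ-sink {X = Q} skew sink

    A-pair : ∀ t r → t ℕ.+ r ≡ K → Pair (lab t) (lab (suc t)) a (G r) (G (suc r)) (λ i → - ρ i) R (H (suc t)) (H t) (A t)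
    A-pair = spin {D = A} path-suc A₀-pair

    -- At the first two steps of `C` the arrows from a mid vertex to the mutated label compose with
    -- those from there to the top vertex, which gives `ρ₁` and `ρ₂`. The weight `ρ₃` is what is
    -- left between the two cancelling steps at the end.
    ρ₁ ρ₂ ρ₃ : Fin N → ℤ
    ρ₁ i = ρ i + G K i * u
    ρ₂ i = ρ₁ i + G (suc K₂) i * v
    ρ₃ i = ρ i + y i * H K

    C₀-pair : Pair zero (suc zero) a (G K) (G (suc K)) ρ R (- u) v (C 0)
    C₀-pair = subst (Pair zero (suc zero) a (G K) (G (suc K)) ρ R (- u) v) (sym path-zero) Q-pair

    advance : ∀ t {p s α β σ αℓ βℓ} → Pair p s a α β σ R αℓ βℓ (μ (lab t) (C t)) → Pair p s a α β σ R αℓ βℓ (C (suc t))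
    advance t = subst (Pair _ _ a _ _ _ R _ _) (sym (path-suc t))

    C₁-pair : Pair (suc zero) zero a (G (suc K₂)) (G K) ρ₁ R (- v) (- u) (C 1)
    C₁-pair = advance 0 (pair-cong (G-step (suc K₂)) (λ _ → refl)
      (λ i → cong (λ z → ρ i + z) (trans (half-≥≥ (2≤⇒0≤ (2≤G (suc K₂) i)) (2≤⇒0≤ (2≤-- 2≤u))) (cong (λ z → G K i * z) (ℤP.neg-involutive u))))
      (λ _ _ → refl) (trans (cong (λ z → - v + z) (half-≤≥ (2≤⇒-≤0 2≤u) 0≤a)) (ℤP.+-identityʳ (- v))) refl
      (pair-step (inj₁ (λ i → 2≤⇒0≤ (2≤G (suc K₂) i))) C₀-pair))

    C₂-pair : Pair zero (suc zero) a (G K₂) (G (suc K₂)) ρ₂ R u (- v) (C 2)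
    C₂-pair = advance 1 (pair-cong (G-step K₂) (λ _ → refl)
      (λ i → cong (λ z → ρ₁ i + z) (trans (half-≥≥ (2≤⇒0≤ (2≤G K₂ i)) (2≤⇒0≤ (2≤-- 2≤v))) (cong (λ z → G (suc K₂) i * z) (ℤP.neg-involutive v))))
      (λ _ _ → refl) (trans (cong (λ z → - - u + z) (half-≤≥ (2≤⇒-≤0 2≤v) 0≤a)) (trans (ℤP.+-identityʳ (- - u)) (ℤP.neg-involutive u))) refl
      (pair-step (inj₁ (λ i → 2≤⇒0≤ (2≤G K₂ i))) C₁-pair))

    C-pair : ∀ t r → t ℕ.+ r ≡ K₂ → Pair (lab t) (lab (suc t)) a (G r) (G (suc r)) ρ₂ R (H (suc t)) (H t) (C (2 ℕ.+ t))
    C-pair = spin {D = λ t → C (2 ℕ.+ t)} (λ t → path-suc (2 ℕ.+ t)) C₂-pair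

    half-neg-neg : ∀ {g h} → + 2 ≤ g → + 2 ≤ h → half (- g) (- h) ≡ - (g * h)
    half-neg-neg {g} {h} p q = trans (half-neg g h) (cong -_ (half-≥≥ (2≤⇒0≤ p) (2≤⇒0≤ q)))

    -- The mid vertices are past their reversal: the mutated label has arrows to them, while the top
    -- vertex has arrows to that label. The composed arrows now go from the top vertex to the mid
    -- vertices and cancel earlier ones; `wind-balance` computes the remainder.
    C₃-pair : Pair (lab (suc K₂)) (lab K₂) a (λ i → - y i) (λ i → - x i) ρ₃ R (H K) (H (suc K₂)) (C (suc K))
    C₃-pair = advance K (pair-cong
      (λ i → trans (cong (λ z → - y i + z) (half-≤≥ (2≤⇒-≤0 (2≤x i)) 0≤a)) (ℤP.+-identityʳ (- y i))) (λ _ → refl)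
      weight (λ _ _ → refl) (H-step K₂) refl
      (pair-step (inj₂ (λ i → 2≤⇒-≤0 (2≤x i))) (C-pair K₂ 0 (ℕP.+-identityʳ K₂))))
      where
      e₁ : ∀ r g g' u v w → ((r + g * u) + g' * v) - w ≡ r + (g * u + g' * v) - w
      e₁ = solve-∀
      e₂ : ∀ r s t → r + (s + t) - s ≡ r + t
      e₂ = solve-∀
      weight : ∀ i → ρ₂ i + half (- x i) (- H (suc K₂)) ≡ ρ₃ i
      weight i = begin
        ρ₂ i + half (- x i) (- H (suc K₂))                                            ≡⟨ cong (λ z → ρ₂ i + z) (half-neg-neg (2≤x i) (2≤H K₂)) ⟩
        ρ₂ i - x i * H (suc K₂)                                                       ≡⟨ e₁ (ρ i) (G K i) (G (suc K₂) i) u v (x i * H (suc K₂)) ⟩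
        ρ i + (G K i * u + G (suc K₂) i * v) - x i * H (suc K₂)                       ≡⟨ cong (λ z → ρ i + z - x i * H (suc K₂)) (wind-balance a (x i) (y i) u v (suc K₂)) ⟩
        ρ i + (x i * H (suc K₂) + y i * H K) - x i * H (suc K₂)                       ≡⟨ e₂ (ρ i) (x i * H (suc K₂)) (y i * H K) ⟩
        ρ₃ i                                                                          ∎
        where open ≡-Reasoning

    -- To be compared with `AK-pair`: same labels, same weights at the top vertex and same `R`, but
    -- `x`, `y` and `ρ` all enter with the opposite sign.
    C₄-pair : Pair (lab K₂) (lab (suc K₂)) a x (λ i → - y i) ρ R (H (suc K)) (H K) (C (suc (suc K)))
    C₄-pair = advance (suc K) (pair-cong
      (λ i → trans (cong (λ z → - - x i + z) (half-≤≥ (2≤⇒-≤0 (2≤y i)) 0≤a)) (trans (ℤP.+-identityʳ (- - x i)) (ℤP.neg-involutive (x i)))) (λ _ → refl)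
      (λ i → trans (cong (λ z → ρ₃ i + z) (half-neg-neg (2≤y i) (2≤H (suc K₂)))) (e (ρ i) (y i * H K)))
      (λ _ _ → refl) (H-step (suc K₂)) refl
      (pair-step (inj₂ (λ i → 2≤⇒-≤0 (2≤y i))) C₃-pair))
      where
      e : ∀ r s → r + s - s ≡ r
      e = solve-∀

    -- Leaving either path creates a fork, and its critical end is none.

    open Forced (top {N}) lab K

    pos-sum : ∀ {r g h} → + 2 ≤ r → + 2 ≤ g → + 2 ≤ h → g < r + g * h × h < r + g * h
    pos-sum {r} p q s = heavy-sum {x = r} {y = - r} q s (sym (ℤP.neg-involutive r)) (inj₁ (≤-< (2≤⇒-≤0 p) q))

    2≤ρ₁ : ∀ i → + 2 ≤ ρ₁ i
    2≤ρ₁ i = ℤP.<⇒≤ (ℤP.≤-<-trans 2≤u (proj₂ (pos-sum (2≤ρ i) (2≤G (suc K₂) i) 2≤u)))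

    2≤ρ₂ : ∀ i → + 2 ≤ ρ₂ i
    2≤ρ₂ i = ℤP.<⇒≤ (ℤP.≤-<-trans 2≤v (proj₂ (pos-sum (2≤ρ₁ i) (2≤G K₂ i) 2≤v)))

    2≤ρ₃ : ∀ i → + 2 ≤ ρ₃ i
    2≤ρ₃ i = ℤP.<⇒≤ (ℤP.≤-<-trans (2≤y i) (proj₁ (pos-sum (2≤ρ i) (2≤y i) (2≤H (suc K₂)))))

    a<G : ∀ r i → a < G (suc (suc r)) i
    a<G r i = a<wind 2≤a (2≤x i) (2≤y i) r

    a<H : ∀ t → a < H (suc (suc t))
    a<H = a<wind 2≤a 2≤v 2≤u

    <-resp : ∀ {w w' z z' : ℤ} → w ≡ w' → z ≡ z' → w' < z' → w < z
    <-resp e f = subst₂ _<_ (sym e) (sym f)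

    split< : ∀ {t T} → t ℕ.< T → ∃[ r ] t ℕ.+ suc r ≡ T
    split< {t} {T} t<T = T ℕ.∸ suc t , trans (ℕP.+-suc t _) (ℕP.m+[n∸m]≡n t<T)

    A-tunnel : Tunnel A
    A-tunnel = record { next = path-suc ; exit = λ {t} t<K → exit t (split< t<K) }
      where
      exit : ∀ t → ∃[ r ] t ℕ.+ suc r ≡ K → ∀ {v} → v ≢ lab t → v ≢ previous t → PreFork v (A t)
      -- At the start the top vertex is a source and its mutation is the way back, so the exits are
      -- `S` and the mid vertices. Later `S` is the way back and the top vertex is an exit instead.
      exit zero (r , refl) {w} ≢p ≢l with kind zo w
      ... | P , refl   = ⊥-elim (≢p refl)
      ... | L , refl   = ⊥-elim (≢l refl)
      ... | S , refl   = preFork-S (λ _ ()) (λ _ ()) (λ i → <-resp (mp i) (sm i) (proj₂ (wind-grows 2≤a (2≤x i) (2≤y i) (suc r))))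
        where
        open Pair (A-pair 0 (suc r) refl)
        open Oriented (orient true true true (A-pair 0 (suc r) refl) 2≤a (2≤G r) (2≤G (suc r)) 2≤R 2≤u (2≤-- 2≤v) (λ i → 2≤-- (2≤ρ i)))
      ... | M i , refl = preFork-M i (λ ()) (<-resp ps (sm i) (a<G r i)) (λ _ ())
        where
        open Pair (A-pair 0 (suc r) refl)
        open Oriented (orient true true true (A-pair 0 (suc r) refl) 2≤a (2≤G r) (2≤G (suc r)) 2≤R 2≤u (2≤-- 2≤v) (λ i → 2≤-- (2≤ρ i)))
      exit (suc t) (r , e) {w} ≢p ≢s with kind (labels (suc t)) w
      ... | P , refl   = ⊥-elim (≢p refl)
      ... | S , refl   = ⊥-elim (≢s refl)
      ... | L , refl   = preFork-L (λ ()) (λ ()) (λ _ _ → <-resp ps lp (a<H t)) (λ _ ())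
        where
        open Pair (A-pair (suc t) (suc r) e)
        open Oriented (orient true false true (A-pair (suc t) (suc r) e) 2≤a (2≤G r) (2≤G (suc r)) 2≤R (2≤H (suc t)) (2≤-- (2≤H t)) (λ i → 2≤-- (2≤ρ i)))
      ... | M i , refl = preFork-M i (λ ()) (<-resp ps (sm i) (a<G r i)) (λ ())
        where
        open Pair (A-pair (suc t) (suc r) e)
        open Oriented (orient true false true (A-pair (suc t) (suc r) e) 2≤a (2≤G r) (2≤G (suc r)) 2≤R (2≤H (suc t)) (2≤-- (2≤H t)) (λ i → 2≤-- (2≤ρ i)))

    C-tunnel : Tunnel C
    C-tunnel = record { next = path-suc ; exit = λ {t} t<K → exit t (split< t<K) }
      where
      exit : ∀ t → ∃[ r ] t ℕ.+ suc r ≡ K → ∀ {v} → v ≢ lab t → v ≢ previous t → PreFork v (C t)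
      -- The top vertex is a sink at `C 0`, and each of the first two mutations reverses its arrow
      -- to one label. The bits thus run through four patterns; from `C 3` on they differ from those
      -- on `A` only in the last one.
      exit zero _ {w} ≢p ≢l with kind zo w
      ... | P , refl   = ⊥-elim (≢p refl)
      ... | L , refl   = ⊥-elim (≢l refl)
      ... | S , refl   = preFork-S (λ ()) (λ ()) (λ i → <-resp (mp i) (sm i) (proj₂ (wind-grows 2≤a (2≤x i) (2≤y i) K)))
        where
        open Pair C₀-pair
        open Oriented (orient false false false C₀-pair 2≤a (2≤G (suc K₂)) (2≤G K) 2≤R (2≤-- 2≤u) (2≤-- 2≤v) (λ i → 2≤-- (2≤ρ i)))
      ... | M i , refl = preFork-M i (λ _ ()) (<-resp ps (sm i) (a<G (suc K₂) i)) (λ ())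
        where
        open Pair C₀-pair
        open Oriented (orient false false false C₀-pair 2≤a (2≤G (suc K₂)) (2≤G K) 2≤R (2≤-- 2≤u) (2≤-- 2≤v) (λ i → 2≤-- (2≤ρ i)))
      exit (suc zero) _ {w} ≢p ≢s with kind oz w
      ... | P , refl   = ⊥-elim (≢p refl)
      ... | S , refl   = ⊥-elim (≢s refl)
      ... | L , refl   = preFork-L (λ _ ()) (λ ()) (λ ()) (λ i _ _ → <-resp (sm i) (ml i) (proj₁ (pos-sum (2≤ρ i) (2≤G (suc K₂) i) 2≤u)))
        where
        open Pair C₁-pair
        open Oriented (orient false true false C₁-pair 2≤a (2≤G K₂) (2≤G (suc K₂)) 2≤R (2≤-- 2≤v) (2≤-- 2≤u) (λ i → 2≤-- (2≤ρ₁ i)))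
      ... | M i , refl = preFork-M i (λ _ ()) (<-resp ps (sm i) (a<G K₂ i))
          (λ _ _ → <-resp (trans ls (ℤP.neg-involutive u)) (ml i) (proj₂ (pos-sum (2≤ρ i) (2≤G (suc K₂) i) 2≤u)))
        where
        open Pair C₁-pair
        open Oriented (orient false true false C₁-pair 2≤a (2≤G K₂) (2≤G (suc K₂)) 2≤R (2≤-- 2≤v) (2≤-- 2≤u) (λ i → 2≤-- (2≤ρ₁ i)))
      exit (suc (suc zero)) (r , refl) {w} ≢p ≢s with kind zo w
      ... | P , refl   = ⊥-elim (≢p refl)
      ... | S , refl   = ⊥-elim (≢s refl)
      ... | L , refl   = preFork-L (λ ()) (λ _ ()) (λ _ ()) (λ i _ _ → <-resp (sm i) (ml i) (proj₁ (pos-sum (2≤ρ₁ i) (2≤G (suc r) i) 2≤v)))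
        where
        open Pair C₂-pair
        open Oriented (orient true true false C₂-pair 2≤a (2≤G r) (2≤G (suc r)) 2≤R 2≤u (2≤-- 2≤v) (λ i → 2≤-- (2≤ρ₂ i)))
      ... | M i , refl = preFork-M i (λ ()) (<-resp ps (sm i) (a<G r i))
          (λ _ _ → <-resp (trans ls (ℤP.neg-involutive v)) (ml i) (proj₂ (pos-sum (2≤ρ₁ i) (2≤G (suc r) i) 2≤v)))
        where
        open Pair C₂-pair
        open Oriented (orient true true false C₂-pair 2≤a (2≤G r) (2≤G (suc r)) 2≤R 2≤u (2≤-- 2≤v) (λ i → 2≤-- (2≤ρ₂ i)))
      exit (suc (suc (suc t))) (r , refl) {w} ≢p ≢s with kind (labels (suc t)) w
      ... | P , refl   = ⊥-elim (≢p refl)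
      ... | S , refl   = ⊥-elim (≢s refl)
      ... | L , refl   = preFork-L (λ ()) (λ ()) (λ _ _ → <-resp ps lp (a<H t)) (λ _ ())
        where
        open Pair (C-pair (suc t) (suc r) refl)
        open Oriented (orient true false false (C-pair (suc t) (suc r) refl) 2≤a (2≤G r) (2≤G (suc r)) 2≤R (2≤H (suc t)) (2≤-- (2≤H t)) (λ i → 2≤-- (2≤ρ₂ i)))
      ... | M i , refl = preFork-M i (λ ()) (<-resp ps (sm i) (a<G r i)) (λ ())
        where
        open Pair (C-pair (suc t) (suc r) refl)
        open Oriented (orient true false false (C-pair (suc t) (suc r) refl) 2≤a (2≤G r) (2≤G (suc r)) 2≤R (2≤H (suc t)) (2≤-- (2≤H t)) (λ i → 2≤-- (2≤ρ₂ i)))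

    2≤-resp : ∀ {w w'} → w ≡ w' → + 2 ≤ w' → + 2 ≤ w
    2≤-resp e = subst (+ 2 ≤_) (sym e)

    C₀-notFork : NotFork (C 0)
    C₀-notFork = sink-notFork top sink {zero} {suc zero} {mid zero} (λ ()) (λ ()) (λ e → top≢mid (sym e))
      (2≤-resp ps 2≤a) (2≤-resp (sm zero) (2≤G K zero)) (2≤-resp (mp zero) (2≤G (suc K₂) zero))
      where
      open Pair C₀-pair
      sink : ∀ {w} → w ≢ top → + 2 ≤ C 0 w top
      sink {w} ne with kind zo w
      ... | P , refl   = 2≤-resp pl (2≤-- 2≤u)
      ... | S , refl   = 2≤-resp sl 2≤v
      ... | L , refl   = ⊥-elim (ne refl)
      ... | M i , refl = 2≤-resp (ml i) (2≤ρ i)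

    AK-pair : Pair (lab K₂) (lab (suc K₂)) a (λ i → - x i) y (λ i → - ρ i) R (H (suc K)) (H K) (A K)
    AK-pair = A-pair K 0 (ℕP.+-identityʳ K)

    -- After complete unwinding the labels have no arrows from the mid vertices that would hold
    -- these in triangles: vertex n-1 is a sink, while n and the two labels form an oriented
    -- triangle avoiding it.
    AK-notFork : NotFork (A K)
    AK-notFork = sink-notFork (mid (fromℕ N')) sink top≢mid (mid≢label (labels K₂) ∘ sym) (mid≢label (Labels-swap (labels K₂)) ∘ sym)
      (2≤-resp lp (2≤H K)) (2≤-resp ps 2≤a) (2≤-resp sl (2≤H (suc K₂)))
      where
      open Pair AK-pair
      below : ∀ {j : Fin N} → j ≢ fromℕ N' → j Fin.< fromℕ N'
      below {j} ne = FinP.≤∧≢⇒< (FinP.≤fromℕ j) ne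
      sink : ∀ {w} → w ≢ mid (fromℕ N') → + 2 ≤ A K w (mid (fromℕ N'))
      sink {w} ne with kind (labels K₂) w
      ... | P , refl   = 2≤-resp (pm (fromℕ N')) (2≤-- (2≤x (fromℕ N')))
      ... | S , refl   = 2≤-resp (sm (fromℕ N')) (2≤y (fromℕ N'))
      ... | L , refl   = 2≤-resp (lm (fromℕ N')) (2≤-- (2≤ρ (fromℕ N')))
      ... | M j , refl = 2≤-resp (mm j (fromℕ N')) (2≤R (below (λ e → ne (cong mid e))))

    -- Distinctness of the visited quivers, and the reversal of the mid vertices.

    record Trace (h : ℕ → ℤ) (t : ℕ) (Y : Matrix (4 ℕ.+ N')) : Set where
      constructor trace
      field
        skew  : Skew Y
        edge  : Y (lab t) (lab (suc t)) ≡ a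
        level : Y top (lab t) ≡ h t

    lab-phase : ∀ {m} s t → lab {m} s ≡ lab t ⊎ (lab {m} s ≡ lab (suc t) × lab {m} (suc s) ≡ lab t)
    lab-phase zero          zero          = inj₁ refl
    lab-phase zero          (suc zero)    = inj₂ (refl , refl)
    lab-phase (suc zero)    zero          = inj₂ (refl , refl)
    lab-phase (suc zero)    (suc zero)    = inj₁ refl
    lab-phase zero          (suc (suc t)) = lab-phase zero t
    lab-phase (suc zero)    (suc (suc t)) = lab-phase (suc zero) t
    lab-phase (suc (suc s)) t             = lab-phase s t

    -- If the next labels differ, the arrows between 1 and 2 point in opposite directions. If they
    -- agree, the levels are the same matrix entry and can be compared.
    trace-distinct : ∀ {h s t Y Z} → (lab {suc N} s ≡ lab t → h s ≢ h t) → Trace h s Y → Trace h t Z → ¬ Y ≈Q Z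
    trace-distinct {h} {s} {t} {Y} {Z} ne (trace sk e l) (trace sk' e' l') eq with lab-phase {suc N} s t
    ... | inj₁ same = ne same (trans (sym l) (trans (eq top (lab s)) (trans (cong (Z top) same) l')))
    ... | inj₂ (p , q) = skew-antisym {X = Y} sk (2≤-resp e 2≤a)
            (2≤-resp (trans (eq (lab (suc s)) (lab s)) (trans (cong₂ Z q p) e')) 2≤a)

    A-level C-level : ℕ → ℤ
    A-level t = H (suc t)
    C-level zero          = - u
    C-level (suc zero)    = - v
    C-level (suc (suc t)) = H (suc t)

    H-< : ∀ {s t} → s ℕ.< t → H s < H t
    H-< p = wind-< 2≤a 2≤v 2≤u (ℕP.<⇒<′ p)

    A-level-distinct : ∀ {s t} → s ℕ.< t → A-level s ≢ A-level t
    A-level-distinct s<t = ℤP.<⇒≢ (H-< (ℕ.s≤s s<t))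

    -- The first two levels `- u` and `- v` may coincide, but they belong to different labels.
    C-level-distinct : ∀ {s t} → s ℕ.< t → lab {suc N} s ≡ lab t → C-level s ≢ C-level t
    C-level-distinct {zero}        {suc zero}    _ ()
    C-level-distinct {zero}        {suc (suc t)} _ _ = ℤP.<⇒≢ (≤-< (2≤⇒-≤0 2≤u) (2≤H t))
    C-level-distinct {suc zero}    {suc zero}    (ℕ.s≤s ())
    C-level-distinct {suc zero}    {suc (suc t)} _ _ = ℤP.<⇒≢ (≤-< (2≤⇒-≤0 2≤v) (2≤H t))
    C-level-distinct {suc (suc s)} {suc (suc t)} (ℕ.s≤s (ℕ.s≤s s<t)) _ = ℤP.<⇒≢ (H-< (ℕ.s≤s s<t))
    C-level-distinct {suc (suc s)} {suc zero}    (ℕ.s≤s ())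

    A-trace : ∀ {t} → t ℕ.≤ K → Trace A-level t (A t) × (∀ i → A t (mid i) top ≡ - ρ i)
    A-trace {t} t≤K = trace skew ps lp , ml
      where open Pair (A-pair t (K ℕ.∸ t) (ℕP.m+[n∸m]≡n t≤K))

    C-trace : ∀ {t} → t ℕ.≤ 2 ℕ.+ K → Trace C-level t (C t) × (∀ i → + 2 ≤ C t (mid i) top)
    C-trace {zero} _ = trace skew ps lp , λ i → 2≤-resp (ml i) (2≤ρ i)
      where open Pair C₀-pair
    C-trace {suc zero} _ = trace skew ps lp , λ i → 2≤-resp (ml i) (2≤ρ₁ i)
      where open Pair C₁-pair
    C-trace {suc (suc t)} (ℕ.s≤s (ℕ.s≤s t≤K)) = late (K ℕ.∸ t) (ℕP.m+[n∸m]≡n t≤K)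
      where
      late : ∀ r → t ℕ.+ r ≡ K → Trace C-level (2 ℕ.+ t) (C (2 ℕ.+ t)) × (∀ i → + 2 ≤ C (2 ℕ.+ t) (mid i) top)
      late zero e with trans (sym (ℕP.+-identityʳ t)) e
      ... | refl = trace skew ps lp , λ i → 2≤-resp (ml i) (2≤ρ i)
        where open Pair C₄-pair
      late (suc zero) e with ℕP.suc-injective (trans (ℕP.+-comm 1 t) e)
      ... | refl = trace skew ps lp , λ i → 2≤-resp (ml i) (2≤ρ₃ i)
        where open Pair C₃-pair
      late (suc (suc r)) e = trace skew ps lp , λ i → 2≤-resp (ml i) (2≤ρ₂ i)
        where open Pair (C-pair t r (ℕP.suc-injective (ℕP.suc-injective (trans (sym (trans (ℕP.+-suc t (suc r)) (cong suc (ℕP.+-suc t r)))) e))))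

    A≉A : ∀ {s t} → s ℕ.< t → t ℕ.≤ K → ¬ A s ≈Q A t
    A≉A s<t t≤K = trace-distinct (λ _ → A-level-distinct s<t) (proj₁ (A-trace (ℕP.<⇒≤ (ℕP.<-≤-trans s<t t≤K)))) (proj₁ (A-trace t≤K))

    C≉C : ∀ {s t} → s ℕ.< t → t ℕ.≤ 2 ℕ.+ K → ¬ C s ≈Q C t
    C≉C s<t t≤ = trace-distinct (C-level-distinct s<t) (proj₁ (C-trace (ℕP.<⇒≤ (ℕP.<-≤-trans s<t t≤)))) (proj₁ (C-trace t≤))

    ρ-distinct : ∀ {Y Z : Matrix (4 ℕ.+ N')} {i} → Y (mid i) top ≡ - ρ i → + 2 ≤ Z (mid i) top → ¬ Y ≈Q Z
    ρ-distinct {i = i} e p eq = ℤP.<⇒≢ (≤-< (2≤⇒-≤0 (2≤ρ i)) p) (trans (sym e) (eq (mid i) top))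

    A≉C : ∀ {s t} → s ℕ.≤ K → t ℕ.≤ 2 ℕ.+ K → ¬ A s ≈Q C t
    A≉C s≤K t≤ = ρ-distinct (proj₂ (A-trace s≤K) zero) (proj₂ (C-trace t≤) zero)

    -- The sign of vertex mid i once the mid vertices from index c on have been mutated.
    ε : ℕ → Fin N → ℤ
    ε c i = if does (toℕ i ℕ.<? c) then - + 1 else + 1

    ε-below : ∀ {c i} → toℕ i ℕ.< c → ε c i ≡ - + 1
    ε-below {c} {i} p rewrite dec-true (toℕ i ℕ.<? c) p = refl

    ε-above : ∀ {c i} → c ℕ.≤ toℕ i → ε c i ≡ + 1
    ε-above {c} {i} p rewrite dec-false (toℕ i ℕ.<? c) (ℕP.≤⇒≯ p) = refl

    ε-off : ∀ {c i} → toℕ i ≢ c → ε c i ≡ ε (suc c) i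
    ε-off {c} {i} ne with ℕP.<-cmp (toℕ i) c
    ... | tri< p _ _ = trans (ε-below p) (sym (ε-below (ℕP.<-trans p (ℕP.n<1+n c))))
    ... | tri≈ _ e _ = ⊥-elim (ne e)
    ... | tri> _ _ p = trans (ε-above (ℕP.<⇒≤ p)) (sym (ε-above p))

    Swept : ℕ → Matrix (4 ℕ.+ N') → Set
    Swept c = Pair (lab K₂) (lab (suc K₂)) a (λ i → ε c i * x i) (λ i → - (ε c i * y i)) (λ i → ε c i * ρ i)
                (λ i j → ε c i * ε c j * R i j) (H (suc K)) (H K)

    AK-swept : Swept N (A K)
    AK-swept = pair-cong (λ i → sym (minus (x i) (all i)))
      (λ i → sym (trans (cong -_ (minus (y i) (all i))) (ℤP.neg-involutive (y i)))) (λ i → sym (minus (ρ i) (all i)))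
      (λ i j → sym (trans (cong (_* R i j) (cong₂ _*_ (all i) (all j))) (ℤP.*-identityˡ (R i j)))) refl refl AK-pair
      where
      all : ∀ i → ε N i ≡ - + 1
      all i = ε-below (FinP.toℕ<n i)
      minus : ∀ {e} w → e ≡ - + 1 → e * w ≡ - w
      minus w refl = ℤP.-1*i≡-i w

    swept-end : ∀ {X} → Swept 0 X → X ≈Q C (2 ℕ.+ K)
    swept-end sw = pair-unique (pair-cong (λ i → plus (x i)) (λ i → cong -_ (plus (y i))) (λ i → plus (ρ i)) (λ i j → plus (R i j)) refl refl sw) C₄-pair
      where
      plus : ∀ w → + 1 * w ≡ w
      plus = ℤP.*-identityˡ

    R-skew : ∀ i j → R j i ≡ - R i j
    R-skew i j = trans (sym (mm j i)) (trans (skew (mid i) (mid j)) (cong -_ (mm i j)))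
      where open Pair Q-pair

    -- Mid vertices below `k` still have arrows to `k`, and those above, being reversed already, now
    -- have arrows to `k` too. So the descending order makes `mid k` a sink.
    swept-step : ∀ {c X} k → toℕ k ≡ c → Swept (suc c) X → Swept c (μ (mid k) X)
    swept-step {X = X} k refl sw = pair-flip k sw
      (neg≤0 (2≤x k)) (ℤP.neg-mono-≤ (neg≤0 (2≤y k))) (neg≤0 (2≤ρ k)) R≤
      (flip (x k) , cong -_ (flip (y k)) , flip (ρ k) , flipR , flipR')
      (λ i ne → let o = ε-off (ne ∘ FinP.toℕ-injective) in
        cong (_* x i) o , cong (λ z → - (z * y i)) o , cong (_* ρ i) o ,
        λ j ne' → cong₂ (λ s t → s * t * R i j) o (ε-off (ne' ∘ FinP.toℕ-injective)))
      where
      c = toℕ k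
      before : ε (suc c) k ≡ - + 1
      before = ε-below {suc c} {k} ℕP.≤-refl
      after : ε c k ≡ + 1
      after = ε-above {c} {k} ℕP.≤-refl
      neg≤0 : ∀ {w} → + 2 ≤ w → ε (suc c) k * w ≤ + 0
      neg≤0 {w} p = subst (_≤ + 0) (sym (trans (cong (_* w) before) (ℤP.-1*i≡-i w))) (2≤⇒-≤0 p)
      negate : ε c k ≡ - ε (suc c) k
      negate = trans after (cong -_ (sym before))
      flip : ∀ w → ε c k * w ≡ - (ε (suc c) k * w)
      flip w = trans (cong (_* w) negate) (sym (ℤP.neg-distribˡ-* (ε (suc c) k) w))
      zero-diagonal : R k k ≡ + 0
      zero-diagonal = i≡-i⇒i≡0 (R-skew k k)
      flipR : ∀ j → ε c k * ε c j * R k j ≡ - (ε (suc c) k * ε (suc c) j * R k j)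
      flipR j with j ≟⊎ k
      ... | inj₁ refl rewrite zero-diagonal = trans (ℤP.*-zeroʳ (ε c k * ε c k)) (cong -_ (sym (ℤP.*-zeroʳ (ε (suc c) k * ε (suc c) k))))
      ... | inj₂ ne = trans (cong₂ (λ s t → s * t * R k j) negate (ε-off (ne ∘ FinP.toℕ-injective))) (e (ε (suc c) k) (ε (suc c) j) (R k j))
        where
        e : ∀ s t r → - s * t * r ≡ - (s * t * r)
        e = solve-∀
      flipR' : ∀ j → ε c j * ε c k * R j k ≡ - (ε (suc c) j * ε (suc c) k * R j k)
      flipR' j = trans (e (ε c j) (ε c k) (R-skew k j)) (trans (cong -_ (flipR j)) (cong -_ (sym (e (ε (suc c) j) (ε (suc c) k) (R-skew k j)))))
        where
        e' : ∀ s t r → s * t * - r ≡ - (t * s * r)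
        e' = solve-∀
        e : ∀ s t {r r'} → r' ≡ - r → s * t * r' ≡ - (t * s * r)
        e s t {r} refl = e' s t r
      R≤ : ∀ j → ε (suc c) k * ε (suc c) j * R k j ≤ + 0
      R≤ j with FinP.<-cmp j k
      ... | tri< j<k _ _ = subst (_≤ + 0) (sym (trans (cong₂ (λ s t → s * t * R k j) before (ε-below (ℕP.<-trans j<k (ℕP.n<1+n c))))
                             (trans (ℤP.*-identityˡ (R k j)) (R-skew j k)))) (2≤⇒-≤0 (2≤R j<k))
      ... | tri≈ _ refl _ = ℤP.≤-reflexive (trans (cong (λ z → ε (suc c) k * ε (suc c) k * z) zero-diagonal) (ℤP.*-zeroʳ (ε (suc c) k * ε (suc c) k)))
      ... | tri> _ _ k<j = subst (_≤ + 0) (sym (trans (cong₂ (λ s t → s * t * R k j) before (ε-above k<j)) (ℤP.-1*i≡-i (R k j)))) (2≤⇒-≤0 (2≤R k<j))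

    sweep : ∀ c (g : Fin c → Fin N) → (∀ i → toℕ (g i) ≡ toℕ i) → ∀ {X} → Swept c X →
      Swept 0 (mutSeq X (descend c g)) × Tour X (descend c g) (λ Y → ∃[ d ] d ℕ.< c × Swept (suc d) Y)
    sweep zero    g e     sw = sw , tour tt [] []
    sweep (suc c) g e {X} sw =
      let k      = g (fromℕ c)
          k≡c    = trans (e (fromℕ c)) (FinP.toℕ-fromℕ c)
          sw' , tour ni vs ds = sweep c (g ∘ inject₁) (λ i → trans (e (inject₁ i)) (FinP.toℕ-inject₁ i)) (swept-step k k≡c sw)
          X-ml   = trans (Pair.ml sw k) (trans (cong (_* ρ k) (ε-below (ℕP.≤-reflexive (cong suc k≡c)))) (ℤP.-1*i≡-i (ρ k)))
          X-ms   = 2≤-resp (trans (Pair.sm sw k) (trans (cong -_ (trans (cong (_* y k) (ε-below (ℕP.≤-reflexive (cong suc k≡c)))) (ℤP.-1*i≡-i (y k))))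
                     (ℤP.neg-involutive (y k)))) (2≤y k)
      in sw' , tour (connected X (mid k) (lab (suc K₂)) (inj₂ X-ms) , ni)
        ((c , ℕP.≤-refl , sw) ∷ All.map (λ (d , d<c , s) → d , ℕP.<-trans d<c (ℕP.n<1+n c) , s) vs)
        -- In all later quivers of the sweep `mid k` has been reversed, so its arrows with the top
        -- vertex tell them from `X`.
        (All.map (λ (d , d<c , s) → ρ-distinct X-ml
          (2≤-resp (trans (Pair.ml s k) (trans (cong (_* ρ k) (ε-above (subst (suc d ℕ.≤_) (sym k≡c) d<c))) (ℤP.*-identityˡ (ρ k)))) (2≤ρ k))) vs ∷ ds)

    A-tour : ∀ r t → t ℕ.+ r ≡ K → ∀ {X} → X ≡ A t → mutSeq X (alternate t r) ≡ A K ×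
      Tour X (alternate t r) (λ Y → ∃[ s ] t ℕ.≤ s × s ℕ.< K × Y ≡ A s)
    A-tour zero    t e refl = cong A (trans (sym (ℕP.+-identityʳ t)) e) , tour tt [] []
    A-tour (suc r) t e refl =
      let t<K = ℕP.m+n≤o⇒m≤o (suc t) (ℕP.≤-reflexive (trans (sym (ℕP.+-suc t r)) e))
          end , tour ni vs ds = A-tour r (suc t) (trans (sym (ℕP.+-suc t r)) e) (sym (path-suc t))
          edge = 2≤-resp (Trace.edge (proj₁ (A-trace (ℕP.<⇒≤ t<K)))) 2≤a
      in end , tour (connected (A t) (lab t) (lab (suc t)) (inj₁ edge) , ni)
        ((t , ℕP.≤-refl , t<K , refl) ∷ All.map (λ (s , t<s , s<K , p) → s , ℕP.<⇒≤ t<s , s<K , p) vs)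
        (All.map (λ { (s , t<s , s<K , refl) → A≉A t<s (ℕP.<⇒≤ s<K) }) vs ∷ ds)

    -- The path `C` read backwards, up to `≈Q` because undoing a mutation restores the matrix
    -- entrywise. The bound `0 < s` keeps out `C 0`, the quiver at which the whole cycle starts.
    C-tour : ∀ r → r ℕ.≤ 2 ℕ.+ K → ∀ {X} → X ≈Q C r → mutSeq X (unwind r) ≈Q C 0 ×
      Tour X (unwind r) (λ Y → ∃[ s ] 0 ℕ.< s × s ℕ.≤ r × Y ≈Q C s)
    C-tour zero    r≤ {X} eq = eq , tour tt [] []
    C-tour (suc r) r≤ {X} eq =
      let end , tour ni vs ds = C-tour r (ℕP.<⇒≤ r≤) (back eq)
          edge = 2≤-resp (trans (eq (lab (suc r)) (lab r)) (Trace.edge (proj₁ (C-trace r≤)))) 2≤a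
      in end , tour (connected X (lab r) (lab (suc r)) (inj₂ edge) , ni)
        ((suc r , ℕ.s≤s ℕ.z≤n , ℕP.≤-refl , eq) ∷ All.map (λ (s , 0<s , s≤r , p) → s , 0<s , ℕP.m≤n⇒m≤1+n s≤r , p) vs)
        (All.map (λ { {Y} (s , 0<s , s≤r , p) f → C≉C (ℕ.s≤s s≤r) r≤
            (≈-trans {Y = Y} (≈-sym {X = Y} p) (≈-trans {Y = X} (≈-sym {X = X} f) eq)) }) vs ∷ ds)
      where
      back : X ≈Q C (suc r) → μ (lab r) X ≈Q C r
      back eq = ≈-trans {Y = μ (lab r) (μ (lab r) (C r))} (μ-cong (lab r) (subst (X ≈Q_) (path-suc r) eq)) (μ-involutive (lab r) (C r))

    -- The cycle assembled.

    cycle : List (Fin (4 ℕ.+ N'))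
    cycle = top ∷ alternate 0 K ++ descend N id ++ unwind (2 ℕ.+ K)

    OffC : Matrix (4 ℕ.+ N') → Set
    OffC Y = ∀ {t} → t ℕ.≤ 2 ℕ.+ K → ¬ Y ≈Q C t

    A-off : ∀ {Y} → ∃[ s ] 0 ℕ.≤ s × s ℕ.< K × Y ≡ A s → OffC Y
    A-off (s , _ , s<K , refl) t≤ = A≉C (ℕP.<⇒≤ s<K) t≤

    M-off : ∀ {Y} → ∃[ d ] d ℕ.< N × Swept (suc d) Y → OffC Y
    M-off (d , _ , sw) t≤ = ρ-distinct (trans (Pair.ml sw zero)
      (trans (cong (_* ρ zero) (ε-below {suc d} (ℕ.s≤s ℕ.z≤n))) (ℤP.-1*i≡-i (ρ zero)))) (proj₂ (C-trace t≤) zero)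

    apart-C : ∀ {Y Z} → OffC Y → ∃[ t ] 0 ℕ.< t × t ℕ.≤ 2 ℕ.+ K × Z ≈Q C t → Y ≉ Z
    apart-C {Y} {Z} off (t , _ , t≤ , p) f = off t≤ (≈-trans {Y = Z} f p)

    -- Mutating the mid vertices as sinks does not change the weight between the top vertex and the
    -- labels, so the swept quivers keep the level of `A K`, which is above all earlier ones on `A`.
    A-M-apart : ∀ {Y Z} → ∃[ s ] 0 ℕ.≤ s × s ℕ.< K × Y ≡ A s → ∃[ d ] d ℕ.< N × Swept (suc d) Z → Y ≉ Z
    A-M-apart (s , _ , s<K , refl) (d , _ , sw) = trace-distinct {t = K} (λ _ → A-level-distinct s<K) (proj₁ (A-trace (ℕP.<⇒≤ s<K)))
      (trace (Pair.skew sw) (Pair.ps sw) (Pair.lp sw))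

    Q-apart : ∀ {Y} → OffC Y ⊎ (∃[ t ] 0 ℕ.< t × t ℕ.≤ 2 ℕ.+ K × Y ≈Q C t) → Q ≉ Y
    Q-apart {Y} (inj₁ off)                e = off ℕ.z≤n (subst (Y ≈Q_) (sym path-zero) (≈-sym {Y = Y} e))
    Q-apart {Y} (inj₂ (t , 0<t , t≤ , p)) e = C≉C 0<t t≤ (subst (_≈Q C t) (sym path-zero) (≈-trans {Y = Y} e p))

    private
      word : List (Fin (4 ℕ.+ N'))
      word = descend N id ++ unwind (2 ℕ.+ K)

      A-end : mutSeq (μ top Q) (alternate 0 K) ≡ A K
      A-end = proj₁ (A-tour K 0 refl {μ top Q} (sym path-zero))

      M-end : mutSeq (A K) (descend N id) ≈Q C (2 ℕ.+ K)
      M-end = swept-end (proj₁ (sweep N id (λ _ → refl) AK-swept))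

      C-end : mutSeq (mutSeq (A K) (descend N id)) (unwind (2 ℕ.+ K)) ≈Q C 0
      C-end = proj₁ (C-tour (2 ℕ.+ K) ℕP.≤-refl M-end)

      A-part : Tour (μ top Q) (alternate 0 K) (λ Y → ∃[ s ] 0 ℕ.≤ s × s ℕ.< K × Y ≡ A s)
      A-part = proj₂ (A-tour K 0 refl {μ top Q} (sym path-zero))

      M-part : Tour (A K) (descend N id) (λ Y → ∃[ d ] d ℕ.< N × Swept (suc d) Y)
      M-part = proj₂ (sweep N id (λ _ → refl) AK-swept)

      C-part : Tour (mutSeq (A K) (descend N id)) (unwind (2 ℕ.+ K)) (λ Y → ∃[ t ] 0 ℕ.< t × t ℕ.≤ 2 ℕ.+ K × Y ≈Q C t)
      C-part = proj₂ (C-tour (2 ℕ.+ K) ℕP.≤-refl M-end)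

      MC-part : Tour (A K) word (λ Y → (∃[ d ] d ℕ.< N × Swept (suc d) Y) ⊎ (∃[ t ] 0 ℕ.< t × t ℕ.≤ 2 ℕ.+ K × Y ≈Q C t))
      MC-part = tour-++ (λ p → apart-C (M-off p)) M-part C-part

      full : Tour (μ top Q) (alternate 0 K ++ word) (λ Y → (∃[ s ] 0 ℕ.≤ s × s ℕ.< K × Y ≡ A s) ⊎
               ((∃[ d ] d ℕ.< N × Swept (suc d) Y) ⊎ (∃[ t ] 0 ℕ.< t × t ℕ.≤ 2 ℕ.+ K × Y ≈Q C t)))
      full = tour-++ (λ { p (inj₁ q) → A-M-apart p q ; p (inj₂ q) → apart-C (A-off p) q }) A-part
               (subst (λ Y → Tour Y word (λ Z → (∃[ d ] d ℕ.< N × Swept (suc d) Z) ⊎ (∃[ t ] 0 ℕ.< t × t ℕ.≤ 2 ℕ.+ K × Z ≈Q C t))) (sym A-end) MC-part)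

    cycle-closed : mutSeq Q cycle ≈Q Q
    cycle-closed = subst₂ _≈Q_ (sym (trans (mutSeq-++ (μ top Q) (alternate 0 K) word)
      (trans (cong (λ Y → mutSeq Y word) A-end) (mutSeq-++ (A K) (descend N id) (unwind (2 ℕ.+ K)))))) path-zero C-end

    cycle-nonIsolated : NoIsolatedMutation Q cycle
    cycle-nonIsolated = connected Q top (suc zero) (inj₂ (2≤-resp (Pair.sl Q-pair) 2≤v)) , Tour.nonIsolated full

    cycle-distinct : AllPairs _≉_ (visited Q cycle)
    cycle-distinct = All.map (λ { (inj₁ p) → Q-apart (inj₁ (A-off p)) ; (inj₂ (inj₁ p)) → Q-apart (inj₁ (M-off p)) ; (inj₂ (inj₂ p)) → Q-apart (inj₂ p) })
      (Tour.visits full) ∷ Tour.distinct full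

    cycle-notPaved : ∀ {B} → B ℕ.≤ K ℕ.+ suc K → ¬ PavedBy B Q cycle
    cycle-notPaved {B} B≤ paved = impossible (trans (sym once) (passages-paved B long paved))
      where
      impossible : + 1 ≢ + 0
      impossible ()
      proper : ¬ Q ≈Q μ top Q
      proper e = A≉C {0} {0} ℕ.z≤n ℕ.z≤n (subst₂ _≈Q_ (sym path-zero) (sym path-zero) (≈-sym {X = Q} e))
      open Crossing top Q proper
      long : ∀ w → Linked _≢_ (top ∷ w ++ [ top ]) → mutSeq (μ top Q) w ≈Q Q → B ℕ.≤ length w
      long w l e = ℕP.≤-trans B≤ (connecting-length A-tunnel C-tunnel C₀-notFork AK-notFork
        (λ s≤K t≤K → A≉C s≤K (ℕP.m≤n⇒m≤o+n 2 t≤K)) w l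
        (subst₂ (λ Y Z → mutSeq Y w ≈Q Z) (sym path-zero) (sym path-zero) e))
      alternate-≢ : ∀ t r → All (_≢ top {N}) (alternate t r)
      alternate-≢ t zero    = []
      alternate-≢ t (suc r) = top≢label (labels t) ∘ sym ∷ alternate-≢ (suc t) r
      unwind-≢ : ∀ r → All (_≢ top {N}) (unwind r)
      unwind-≢ zero    = []
      unwind-≢ (suc r) = top≢label (labels r) ∘ sym ∷ unwind-≢ r
      descend-≢ : ∀ c g → All (_≢ top {N}) (descend c g)
      descend-≢ zero    g = []
      descend-≢ (suc c) g = top≢mid ∘ sym ∷ descend-≢ c (g ∘ inject₁)
      once : passages Q cycle ≡ + 1
      once = cong₂ _+_ (trans (passage-ℓ Q) (endpoint-C (≈-refl {X = Q})))
        (passages-≢ (μ top Q) (AllP.++⁺ (alternate-≢ 0 K) (AllP.++⁺ (descend-≢ N id) (unwind-≢ (2 ℕ.+ K)))))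

  -- The given exchange matrix as a wound quiver.

  module _ {m : ℕ} (q : Fin (2 ℕ.+ m) → Fin (2 ℕ.+ m) → ℤ) (k : ℕ) where

    private
      inject< : ∀ {n} (g : Fin n) (l : Fin.Fin′ g) → Fin.inject l Fin.< g
      inject< (suc g) zero    = ℕ.s≤s ℕ.z≤n
      inject< (suc g) (suc l) = ℕ.s≤s (inject< g l)

      inject<-asym : ∀ {n} (g : Fin n) (l : Fin.Fin′ g) → ¬ g Fin.< Fin.inject l
      inject<-asym g l p = ℕP.<-asym p (inject< g l)

    theQuiver-< : ∀ {i j} → i Fin.< j → theQuiver q k i j ≡ bUpper q k i j
    theQuiver-< {i} {j} i<j with Fin.compare i j
    ... | Fin.less _ _    = refl
    ... | Fin.equal _     = ⊥-elim (ℕP.<-irrefl refl i<j)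
    ... | Fin.greater g l = ⊥-elim (inject<-asym g l i<j)

    theQuiver-> : ∀ {i j} → j Fin.< i → theQuiver q k i j ≡ - bUpper q k j i
    theQuiver-> {i} {j} j<i with Fin.compare i j
    ... | Fin.less g l    = ⊥-elim (inject<-asym g l j<i)
    ... | Fin.equal _     = ⊥-elim (ℕP.<-irrefl refl j<i)
    ... | Fin.greater _ _ = refl

    theQuiver-diagonal : ∀ i → theQuiver q k i i ≡ + 0
    theQuiver-diagonal i = go i i refl
      where
      go : ∀ i j → i ≡ j → theQuiver q k i j ≡ + 0
      go i j e with Fin.compare i j
      ... | Fin.less g l    = ⊥-elim (ℕP.<-irrefl (cong toℕ e) (inject< g l))
      ... | Fin.equal _     = refl
      ... | Fin.greater g l = ⊥-elim (ℕP.<-irrefl (cong toℕ (sym e)) (inject< g l))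

    theQuiver-skew : Skew (theQuiver q k)
    theQuiver-skew i j with FinP.<-cmp i j
    ... | tri< i<j _ _  = trans (theQuiver-> i<j) (cong -_ (sym (theQuiver-< i<j)))
    ... | tri≈ _ refl _ = trans (theQuiver-diagonal i) (cong -_ (sym (theQuiver-diagonal i)))
    ... | tri> _ _ j<i  = trans (theQuiver-< j<i) (trans (sym (ℤP.neg-involutive _)) (cong -_ (sym (theQuiver-> j<i))))

  middle-mid : ∀ {N} (i : Fin N) → middle (mid i) ≡ true
  middle-mid {N} i = dec-true (toℕ (mid i) ℕ.≤? suc N)
    (ℕ.s≤s (subst (λ t → suc t ℕ.≤ N) (sym (FinP.toℕ-inject₁ i)) (FinP.toℕ<n i)))

  middle-top : ∀ {N} → middle (top {N}) ≡ false
  middle-top {N} = dec-false (toℕ (top {N}) ℕ.≤? suc N)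
    (λ p → ℕP.<-irrefl refl (subst (λ t → 2 ℕ.+ t ℕ.≤ suc N) (FinP.toℕ-fromℕ N) p))

  module _ {N' k : ℕ} (q : Fin (4 ℕ.+ N') → Fin (4 ℕ.+ N') → ℤ) where

    private
      N : ℕ
      N = suc N'
      Q : Matrix (3 ℕ.+ N)
      Q = theQuiver q (suc k)
      a : ℤ
      a = q zero (suc zero)
      x y ρ : Fin N → ℤ
      x i = q zero (mid i)
      y i = q (suc zero) (mid i)
      ρ i = q (mid i) top

    mid<top : ∀ (i : Fin N) → mid i Fin.< top {N}
    mid<top i = ℕ.s≤s (ℕ.s≤s (subst₂ ℕ._<_ (sym (FinP.toℕ-inject₁ i)) (sym (FinP.toℕ-fromℕ N)) (FinP.toℕ<n i)))

    mid<mid : ∀ {i j : Fin N} → i Fin.< j → mid i Fin.< mid j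
    mid<mid {i} {j} p = ℕ.s≤s (ℕ.s≤s (subst₂ ℕ._<_ (sym (FinP.toℕ-inject₁ i)) (sym (FinP.toℕ-inject₁ j)) p))

    -- The given coefficients are those of `wind-pseq`, so the mid vertices are wound exactly so far
    -- that `2 + 2 * k` mutations bring them back to the initial weights. Row 1 is negative there
    -- because the arrows go from the mid vertices to vertex 1.
    theQuiver-pair : Pair zero (suc zero) a (λ i → wind a (x i) (y i) (2 ℕ.+ 2 ℕ.* k)) (λ i → wind a (x i) (y i) (3 ℕ.+ 2 ℕ.* k))
      ρ (λ i j → Q (mid i) (mid j)) (- q zero top) (q (suc zero) top) Q
    theQuiver-pair = record
      { lbl  = zo
      ; skew = theQuiver-skew q (suc k)
      ; ps   = theQuiver-< q (suc k) {zero} {suc zero} (ℕ.s≤s ℕ.z≤n)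
      ; mp   = λ i → trans (theQuiver-> q (suc k) {mid i} {zero} (ℕ.s≤s ℕ.z≤n)) (trans (cong -_ (row₁ i))
                 (e₁ (p (2 ℕ.* k)) (p (suc (2 ℕ.* k))) (x i) (y i) (wind-pseq a (x i) (y i) (2 ℕ.* k))))
      ; sm   = λ i → trans (theQuiver-< q (suc k) {suc zero} {mid i} (ℕ.s≤s (ℕ.s≤s ℕ.z≤n)))
                 (trans (row₂ i) (sym (wind-pseq a (x i) (y i) (suc (2 ℕ.* k)))))
      ; ml   = λ i → theQuiver-< q (suc k) (mid<top i)
      ; mm   = λ i j → refl
      ; lp   = trans (theQuiver-> q (suc k) {top} {zero} (ℕ.s≤s ℕ.z≤n)) (cong -_ top₁)
      ; sl   = trans (theQuiver-< q (suc k) {suc zero} {top} (ℕ.s≤s (ℕ.s≤s ℕ.z≤n))) top₂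
      }
      where
      p : ℕ → ℤ
      p = pseq a
      row₁ : ∀ i → bUpper q (suc k) zero (mid i) ≡ - (p (2 ℕ.* k) * x i) - p (suc (2 ℕ.* k)) * y i
      -- Once `2 * suc k` is written as `2 + 2 * k`, the truncated subtractions in the indices
      -- compute.
      row₁ i rewrite middle-mid i = cong (λ t → - (p (t ℕ.∸ 2) * x i) - p (t ℕ.∸ 1) * y i) (ℕP.*-suc 2 k)
      row₂ : ∀ i → bUpper q (suc k) (suc zero) (mid i) ≡ p (suc (2 ℕ.* k)) * x i + p (2 ℕ.+ 2 ℕ.* k) * y i
      row₂ i rewrite middle-mid i = cong (λ t → p (t ℕ.∸ 1) * x i + p t * y i) (ℕP.*-suc 2 k)
      top₁ : bUpper q (suc k) zero top ≡ q zero top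
      top₁ rewrite middle-top {N} = refl
      top₂ : bUpper q (suc k) (suc zero) top ≡ q (suc zero) top
      top₂ rewrite middle-top {N} = refl
      e₁ : ∀ s t x y {w} → w ≡ s * x + t * y → - (- (s * x) - t * y) ≡ w
      e₁ s t x y refl = e s t x y
        where
        e : ∀ s t x y → - (- (s * x) - t * y) ≡ s * x + t * y
        e = solve-∀

    module _ (hq : ∀ i j → i Fin.< j → + 2 ≤ q i j) where

      open Winding {N' = N'} {a} {q zero top} {q (suc zero) top} {x} {y} {ρ} {λ i j → Q (mid i) (mid j)}
        (hq zero (suc zero) (ℕ.s≤s ℕ.z≤n)) (hq zero top (ℕ.s≤s ℕ.z≤n)) (hq (suc zero) top (ℕ.s≤s (ℕ.s≤s ℕ.z≤n)))
        (λ i → hq zero (mid i) (ℕ.s≤s ℕ.z≤n)) (λ i → hq (suc zero) (mid i) (ℕ.s≤s (ℕ.s≤s ℕ.z≤n))) (λ i → hq (mid i) top (mid<top i))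
        (λ {i} {j} p → subst (+ 2 ≤_) (sym (theQuiver-< q (suc k) (mid<mid p))) (hq (mid i) (mid j) (mid<mid p)))
        (2 ℕ.* k) Q theQuiver-pair hiding (N)

      private
        cycle≡ : cycle ≡ theCycle (suc k)
        cycle≡ = trans (cong (λ K → top ∷ alternate 0 K ++ descend N id ++ unwind (2 ℕ.+ K)) (sym (ℕP.*-suc 2 k))) (sym (theCycle≡walk (suc k)))

      theCycle-isMutationCycle : IsMutationCycle Q (theCycle (suc k))
      theCycle-isMutationCycle = subst CyclicallyDistinct (sym (theCycle≡walk (suc k))) (walk-distinct k) ,
        subst (λ w → NoIsolatedMutation Q w × (mutSeq Q w ≈Q Q)) cycle≡ (cycle-nonIsolated , cycle-closed)

      theCycle-visits-distinct : ∀ (b c : Fin (length (theCycle {suc N} (suc k)))) → b ≢ c →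
        ¬ (mutSeq Q (take (toℕ b) (theCycle (suc k))) ≈Q mutSeq Q (take (toℕ c) (theCycle (suc k))))
      theCycle-visits-distinct = subst
        (λ w → ∀ (b c : Fin (length w)) → b ≢ c → ¬ (mutSeq Q (take (toℕ b) w) ≈Q mutSeq Q (take (toℕ c) w)))
        cycle≡ (visited-distinct cycle cycle-distinct)

      theCycle-notPaved : ¬ PavedBy (4 ℕ.* suc k) Q (theCycle (suc k))
      theCycle-notPaved = subst (λ w → ¬ PavedBy (4 ℕ.* suc k) Q w) cycle≡ (cycle-notPaved bound)
        where
        bound : 4 ℕ.* suc k ℕ.≤ K ℕ.+ suc K
        bound = ℕP.≤-trans (ℕP.≤-reflexive (e k)) (ℕP.+-monoʳ-≤ K (ℕP.n≤1+n K))
          where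
          e : ∀ k → 4 ℕ.* suc k ≡ (2 ℕ.+ 2 ℕ.* k) ℕ.+ (2 ℕ.+ 2 ℕ.* k)
          e = ℕSolver.solve-∀

open import Data.Nat using (_+_; _*_; _≤_; s≤s)

theorem1p1 : (m k : ℕ) → 4 ≤ 2 + m → 1 ≤ k →
    (q : Fin (2 + m) → Fin (2 + m) → ℤ) →
    (∀ i j → i Fin.< j → + 2 ℤ.≤ q i j) →
    (IsMutationCycle (theQuiver q k) (theCycle k)
    × length (theCycle {m} k) ≡ (2 + m) + 4 * k)
    × (∀ (a b : Fin (length (theCycle {m} k))) → a ≢ b →
    ¬ (mutSeq (theQuiver q k) (take (toℕ a) (theCycle k))
    ≈Q mutSeq (theQuiver q k) (take (toℕ b) (theCycle k))))
    × ¬ PavedBy (4 * k) (theQuiver q k) (theCycle k)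
theorem1p1 (suc (suc m)) (suc k) _ _ q hq =
  (theCycle-isMutationCycle q hq , trans (cong length (theCycle≡walk (suc k))) (length-walk (suc k))) ,
  theCycle-visits-distinct q hq ,
  theCycle-notPaved q hq
theorem1p1 zero          _    (s≤s (s≤s ()))
theorem1p1 (suc zero)    _    (s≤s (s≤s (s≤s ())))
theorem1p1 (suc (suc m)) zero _ ()
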